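{- Let $\mathcal F[\sigma]$ be a fragment of logic equivalent to a variety of finite monoids $\mathbf V$ which is not a variety of groups. Let $L$ be a regular language and $s$ its stability index. Then the following statements are equivalent: (1) $L$ belongs to $\mathcal F[\sigma,+1,\mathrm{MOD}]$; (2) $L$ belongs to $\mathcal F[\sigma,+1,\mathrm{MOD}^{s}]$. Furthermore, if $\mathcal F[\sigma,+1]$ is decidable, then so is $\mathcal F[\sigma,+1,\mathrm{MOD}]$.
   Context: Logic. A word $u$ over a finite alphabet $A$ is a set of positions $0,\dots,|u|-1$ labelled by letters. Formulas are monadic second order formulas over words; a signature $\sigma$ is a set of numerical predicates, and letter predicates $\mathbf a(x)$ (position $x$ carries letter $a$) are always available, for letters of any finite alphabet. A fragment of logic $\mathcal F[\sigma]$ is a set of closed formulas of $\mathrm{MSO}[\sigma]$ that contains the quantifier-free formulas and is closed under conjunction, disjunction and quantifier-free substitution (if $\varphi\in\mathcal F[\sigma]$ and $\psi(x_1,\dots,x_n)$ is a quantifier-free subformula of $\varphi$, then replacing $\psi$ by another quantifier-free formula over $\sigma$ with the same set of free variables gives a formula of $\mathcal F[\sigma]$). For a class of predicates $\sigma'$, the enrichment $\mathcal F[\sigma,\sigma']$ is the closure of $\mathcal F[\sigma]$ under quantifier-free substitutions with predicates ranging over $\sigma\cup\sigma'$. $\mathcal F[\sigma]$ also denotes the class of languages defined by its formulas (over each finite alphabet). The symbol $+1$ denotes the class of descriptive local predicates $\mathbf a(x+k)$, $\mathbf a(\min+k)$, $\mathbf a(\max-k)$ for $k\ge0$, holding if the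 position $x+k$ (resp. the $k$-th position after the first one, the $k$-th position before the last one) is labelled by $a$. For $d\ge 1$, $\mathrm{MOD}^d$ consists of, for $0\le i<d$, the unary predicates $\mathbf{MOD}_i^d(x)$ (position $x$ is congruent to $i$ mod $d$) and the constants $\mathbf D_i^d$ (the length of the word is congruent to $i$ mod $d$); $\mathrm{MOD}=\bigcup_{d\ge1}\mathrm{MOD}^d$. A fragment is decidable if, given a regular language, one can decide whether it is definable by a formula of the fragment. When $+1$ is in the signature, recognition is by semigroups via morphisms from $A^+$ (languages are considered as subsets of $A^+$). Algebra. A variety of monoids is a nonempty class of finite monoids closed under division (quotients of submonoids) and finite direct products. $\mathcal F[\sigma]$ is equivalent to $\mathbf V$ if the languages definable in $\mathcal F[\sigma]$ are exactly those recognized by a monoid of $\mathbf V$. The stability index of a regular language $L$ with syntactic morphism $\eta_L:A^*\to M_L$ is the least positive integer $s$ with $\eta_L(A^s)=\eta_L(A^{2s})$. -}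

module Defs where

open import Algebra.Bundles using (Monoid)
open import Algebra.Structures using (IsMonoid; IsGroup)
open import Algebra.Morphism.Structures using (module MonoidMorphisms)
import Algebra.Construct.DirectProduct as DirectProduct
open import Data.Bool.Base using (Bool; T)
open import Data.Empty using (⊥)
open import Data.Fin.Base using (Fin; toℕ)
open import Data.Fin.Properties using (any?; nonZeroIndex)
open import Data.Fin.Subset using (Subset; ⁅_⁆; _∪_; ⋃) renaming (_∈_ to _∈ₛ_; ⊥ to ∅ₛ)
open import Data.List.Base using (List; []; _∷_; _++_; length; lookup; foldl; ++-[]-rawMonoid)
open import Data.List.Properties using (++-assoc; ++-identityʳ)
open import Data.Nat.Base using (ℕ; suc; _+_; _*_; _≤_; _%_)
open import Data.Nat.Properties using (_≟_)
open import Data.Product.Base using (∃-syntax; _×_; _,_)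
open import Data.Sum.Base using (_⊎_; inj₁; inj₂)
open import Data.Unit.Base using (⊤)
import Data.Vec.Base as Vec
open Vec using (Vec; []; _∷_)
open import Function.Base using (_∘_; id)
open import Function.Bundles using (_⇔_)
open import Function.Definitions using (Surjective)
open import Function.Properties.Equivalence using (⇔-isEquivalence)
open import Level using (Level; 0ℓ; _⊔_) renaming (suc to lsuc)
open import Relation.Binary.Core using (Rel)
open import Relation.Binary.Structures using (IsEquivalence)
open import Relation.Binary.PropositionalEquality using (_≡_; refl; cong; sym)
open import Relation.Nullary using (¬_; Dec; does; _×-dec_)
open import Relation.Unary using (Pred; _∈_; _≐_)

private variable
  f v : Level
  k p q r : ℕ

------------------------------------------------------------------------
-- Words and languages

-- Letters are natural numbers and every finite alphabet is an initial
-- segment Fin k.  Formulas are thus not tied to one alphabet; on words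
-- over Fin k the letter predicates for letters ≥ k are false.

Letter : Set
Letter = ℕ

Word : ℕ → Set
Word k = List (Fin k)

Language : ℕ → Set₁
Language k = Pred (Word k) 0ℓ

record DFA (k : ℕ) : Set where
  field
    states : ℕ
    start  : Fin states
    step   : Fin states → Fin k → Fin states
    final  : Subset states

  language : Language k
  language w = foldl step start w ∈ₛ final

Regular : Language k → Set
Regular {k} L = ∃[ 𝒜 ] ∀ w → w ∈ L ⇔ w ∈ DFA.language {k} 𝒜

------------------------------------------------------------------------
-- Signatures

-- A labelling of the positions 0, …, n - 1.

Labelling : ℕ → Set
Labelling n = Fin n → Letter

-- Besides numerical predicates, enrichments may use predicates that
-- depend on the labels.

record Signature : Set₁ where
  field
    Symbol : ℕ → Set
    interp : Symbol r → ∀ {n} → Labelling n → Vec (Fin n) r → Bool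

open Signature

-- A numerical predicate of arity r is, for every length n, a set of
-- r-tuples of positions, given by its characteristic function.

record NumericalSignature : Set₁ where
  field
    NumSymbol : ℕ → Set
    relation  : NumSymbol r → ∀ n → Vec (Fin n) r → Bool

open NumericalSignature

numerical : NumericalSignature → Signature
numerical σ = record
  { Symbol = NumSymbol σ
  ; interp = λ R {n} _ → relation σ R n
  }

infixr 6 _⊕_

_⊕_ : Signature → Signature → Signature
S ⊕ S′ = record
  { Symbol = λ r → Symbol S r ⊎ Symbol S′ r
  ; interp = λ { (inj₁ R) → interp S R ; (inj₂ R) → interp S′ R }
  }

-- letterAt+ a j is 𝐚(x+j), letterMin+ a j is 𝐚(min+j), and
-- letterMax- a j is 𝐚(max-j).

data LocalSymbol : ℕ → Set where
  letterAt+  : Letter → ℕ → LocalSymbol 1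
  letterMin+ : Letter → ℕ → LocalSymbol 0
  letterMax- : Letter → ℕ → LocalSymbol 0

-- These are false when the position referred to does not exist.

localInterp : LocalSymbol r → ∀ {n} → Labelling n → Vec (Fin n) r → Bool
localInterp (letterAt+ a j) ℓ (x ∷ []) =
  does (any? λ y → (toℕ y ≟ toℕ x + j) ×-dec (ℓ y ≟ a))
localInterp (letterMin+ a j) ℓ [] =
  does (any? λ y → (toℕ y ≟ j) ×-dec (ℓ y ≟ a))
localInterp (letterMax- a j) {n} ℓ [] =
  does (any? λ y → (suc (toℕ y + j) ≟ n) ×-dec (ℓ y ≟ a))

Local : Signature
Local = record { Symbol = LocalSymbol ; interp = localInterp }

data ModSymbol (d : ℕ) : ℕ → Set where
  position≡ : Fin d → ModSymbol d 1
  length≡   : Fin d → ModSymbol d 0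

modRelation : ∀ {d} → ModSymbol d r → ∀ n → Vec (Fin n) r → Bool
modRelation {d = d} (position≡ i) n (x ∷ []) =
  does (_%_ (toℕ x) d {{nonZeroIndex i}} ≟ toℕ i)
modRelation {d = d} (length≡ i) n [] =
  does (_%_ n d {{nonZeroIndex i}} ≟ toℕ i)

MOD^ : ℕ → Signature
MOD^ d = numerical record { NumSymbol = ModSymbol d ; relation = modRelation }

-- The modulus 0 contributes no symbols, as Fin 0 is empty.

MOD : Signature
MOD = numerical record
  { NumSymbol = λ r → ∃[ d ] ModSymbol d r
  ; relation  = λ (d , R) → modRelation R
  }

------------------------------------------------------------------------
-- Monadic second order formulas

-- Formula S p q has p first-order and q set variables in scope
-- (de Bruijn indices).

infix  8 _∈′_
infixr 7 _∧′_
infixr 6 _∨′_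

data Formula (S : Signature) (p q : ℕ) : Set where
  ⊤′ ⊥′     : Formula S p q
  letter    : Letter → Fin p → Formula S p q
  atom      : Symbol S r → Vec (Fin p) r → Formula S p q
  _∈′_      : Fin p → Fin q → Formula S p q
  ¬′_       : Formula S p q → Formula S p q
  _∧′_ _∨′_ : Formula S p q → Formula S p q → Formula S p q
  ∃₁ ∀₁     : Formula S (suc p) q → Formula S p q
  ∃₂ ∀₂     : Formula S p (suc q) → Formula S p q

Sentence : Signature → Set
Sentence S = Formula S 0 0

private variable
  S S′ : Signature

-- Atoms are decidable and quantifiers range over finite sets, so
-- satisfaction is decidable and the semantics is classical.

Sat : ∀ {n} → Labelling n → Vec (Fin n) p → Vec (Subset n) q → Formula S p q → Set
Sat ℓ ρ θ ⊤′           = ⊤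
Sat ℓ ρ θ ⊥′           = ⊥
Sat ℓ ρ θ (letter a x) = ℓ (Vec.lookup ρ x) ≡ a
Sat {S = S} ℓ ρ θ (atom R xs) = T (interp S R ℓ (Vec.map (Vec.lookup ρ) xs))
Sat ℓ ρ θ (x ∈′ X)     = Vec.lookup ρ x ∈ₛ Vec.lookup θ X
Sat ℓ ρ θ (¬′ φ)       = ¬ Sat ℓ ρ θ φ
Sat ℓ ρ θ (φ ∧′ ψ)     = Sat ℓ ρ θ φ × Sat ℓ ρ θ ψ
Sat ℓ ρ θ (φ ∨′ ψ)     = Sat ℓ ρ θ φ ⊎ Sat ℓ ρ θ ψ
Sat ℓ ρ θ (∃₁ φ)       = ∃[ x ] Sat ℓ (x ∷ ρ) θ φ
Sat ℓ ρ θ (∀₁ φ)       = ∀ x → Sat ℓ (x ∷ ρ) θ φ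
Sat ℓ ρ θ (∃₂ φ)       = ∃[ X ] Sat ℓ ρ (X ∷ θ) φ
Sat ℓ ρ θ (∀₂ φ)       = ∀ X → Sat ℓ ρ (X ∷ θ) φ

infix 4 _⊨_

_⊨_ : Word k → Sentence S → Set
w ⊨ φ = Sat (toℕ ∘ lookup w) [] [] φ

data QuantifierFree {S : Signature} {p q : ℕ} : Formula S p q → Set where
  ⊤′     : QuantifierFree ⊤′
  ⊥′     : QuantifierFree ⊥′
  letter : ∀ a x → QuantifierFree (letter a x)
  atom   : (R : Symbol S r) (xs : Vec (Fin p) r) → QuantifierFree (atom R xs)
  _∈′_   : ∀ x X → QuantifierFree (x ∈′ X)
  ¬′_    : ∀ {φ} → QuantifierFree φ → QuantifierFree (¬′ φ)
  _∧′_   : ∀ {φ ψ} → QuantifierFree φ → QuantifierFree ψ → QuantifierFree (φ ∧′ ψ)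
  _∨′_   : ∀ {φ ψ} → QuantifierFree φ → QuantifierFree ψ → QuantifierFree (φ ∨′ ψ)

free₁ : Formula S p q → Subset p
free₁ ⊤′           = ∅ₛ
free₁ ⊥′           = ∅ₛ
free₁ (letter a x) = ⁅ x ⁆
free₁ (atom R xs)  = ⋃ (Vec.toList (Vec.map ⁅_⁆ xs))
free₁ (x ∈′ X)     = ⁅ x ⁆
free₁ (¬′ φ)       = free₁ φ
free₁ (φ ∧′ ψ)     = free₁ φ ∪ free₁ ψ
free₁ (φ ∨′ ψ)     = free₁ φ ∪ free₁ ψ
free₁ (∃₁ φ)       = Vec.tail (free₁ φ)
free₁ (∀₁ φ)       = Vec.tail (free₁ φ)
free₁ (∃₂ φ)       = free₁ φ
free₁ (∀₂ φ)       = free₁ φ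

free₂ : Formula S p q → Subset q
free₂ ⊤′           = ∅ₛ
free₂ ⊥′           = ∅ₛ
free₂ (letter a x) = ∅ₛ
free₂ (atom R xs)  = ∅ₛ
free₂ (x ∈′ X)     = ⁅ X ⁆
free₂ (¬′ φ)       = free₂ φ
free₂ (φ ∧′ ψ)     = free₂ φ ∪ free₂ ψ
free₂ (φ ∨′ ψ)     = free₂ φ ∪ free₂ ψ
free₂ (∃₁ φ)       = free₂ φ
free₂ (∀₁ φ)       = free₂ φ
free₂ (∃₂ φ)       = Vec.tail (free₂ φ)
free₂ (∀₂ φ)       = Vec.tail (free₂ φ)

-- φ ⇝ φ′: φ′ arises from φ by replacing one occurrence of a
-- quantifier-free subformula by a quantifier-free formula with the
-- same free variables.

infix 4 _⇝_

data _⇝_ {S : Signature} {p q : ℕ} : Formula S p q → Formula S p q → Set where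
  replace : ∀ {ψ ψ′} → QuantifierFree ψ → QuantifierFree ψ′ →
            free₁ ψ ≡ free₁ ψ′ → free₂ ψ ≡ free₂ ψ′ → ψ ⇝ ψ′
  in-¬  : ∀ {φ φ′} → φ ⇝ φ′ → ¬′ φ ⇝ ¬′ φ′
  in-∧ˡ : ∀ {φ φ′ χ} → φ ⇝ φ′ → φ ∧′ χ ⇝ φ′ ∧′ χ
  in-∧ʳ : ∀ {φ φ′ χ} → φ ⇝ φ′ → χ ∧′ φ ⇝ χ ∧′ φ′
  in-∨ˡ : ∀ {φ φ′ χ} → φ ⇝ φ′ → φ ∨′ χ ⇝ φ′ ∨′ χ
  in-∨ʳ : ∀ {φ φ′ χ} → φ ⇝ φ′ → χ ∨′ φ ⇝ χ ∨′ φ′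
  in-∃₁ : ∀ {φ φ′} → φ ⇝ φ′ → ∃₁ φ ⇝ ∃₁ φ′
  in-∀₁ : ∀ {φ φ′} → φ ⇝ φ′ → ∀₁ φ ⇝ ∀₁ φ′
  in-∃₂ : ∀ {φ φ′} → φ ⇝ φ′ → ∃₂ φ ⇝ ∃₂ φ′
  in-∀₂ : ∀ {φ φ′} → φ ⇝ φ′ → ∀₂ φ ⇝ ∀₂ φ′

------------------------------------------------------------------------
-- Fragments and enrichments

record IsFragment {S : Signature} (F : Pred (Sentence S) f) : Set f where
  field
    quantifier-free : ∀ {φ} → QuantifierFree φ → φ ∈ F
    ∧-closed        : ∀ {φ ψ} → φ ∈ F → ψ ∈ F → φ ∧′ ψ ∈ F
    ∨-closed        : ∀ {φ ψ} → φ ∈ F → ψ ∈ F → φ ∨′ ψ ∈ F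
    ⇝-closed        : ∀ {φ φ′} → φ ∈ F → φ ⇝ φ′ → φ′ ∈ F

embed : Formula S p q → Formula (S ⊕ S′) p q
embed ⊤′           = ⊤′
embed ⊥′           = ⊥′
embed (letter a x) = letter a x
embed (atom R xs)  = atom (inj₁ R) xs
embed (x ∈′ X)     = x ∈′ X
embed (¬′ φ)       = ¬′ embed φ
embed (φ ∧′ ψ)     = embed φ ∧′ embed ψ
embed (φ ∨′ ψ)     = embed φ ∨′ embed ψ
embed (∃₁ φ)       = ∃₁ (embed φ)
embed (∀₁ φ)       = ∀₁ (embed φ)
embed (∃₂ φ)       = ∃₂ (embed φ)
embed (∀₂ φ)       = ∀₂ (embed φ)

data Enrich {S : Signature} (F : Pred (Sentence S) f) (S′ : Signature) :
            Pred (Sentence (S ⊕ S′)) f where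
  base       : ∀ {φ} → φ ∈ F → embed φ ∈ Enrich F S′
  substitute : ∀ {φ φ′} → φ ∈ Enrich F S′ → φ ⇝ φ′ → φ′ ∈ Enrich F S′

Definable : Pred (Sentence S) f → Language k → Set f
Definable F L = ∃[ φ ] φ ∈ F × (∀ w → w ∈ L ⇔ w ⊨ φ)

-- Definability as a set of nonempty words: the empty word is ignored.

Definable⁺ : Pred (Sentence S) f → Language k → Set f
Definable⁺ {k = k} F L =
  ∃[ φ ] φ ∈ F × (∀ (a : Fin k) w → a ∷ w ∈ L ⇔ a ∷ w ⊨ φ)

-- The decision problem on nonempty words, its input being a
-- regular language presented by an automaton.

Decidable⁺ : Pred (Sentence S) f → Set f
Decidable⁺ F = ∀ {k} (𝒜 : DFA k) → Dec (Definable⁺ F (DFA.language 𝒜))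

------------------------------------------------------------------------
-- Varieties of finite monoids

record FiniteMonoid : Set where
  field
    size     : ℕ
    _∙_      : Fin size → Fin size → Fin size
    ε        : Fin size
    isMonoid : IsMonoid _≡_ _∙_ ε

  Carrier : Set
  Carrier = Fin size

  monoid : Monoid 0ℓ 0ℓ
  monoid = record { isMonoid = isMonoid }

open FiniteMonoid using (monoid)

module _ (M N : Monoid 0ℓ 0ℓ) where
  open MonoidMorphisms (Monoid.rawMonoid M) (Monoid.rawMonoid N)

  IsHomomorphism IsEmbedding IsIsomorphism : (Monoid.Carrier M → Monoid.Carrier N) → Set
  IsHomomorphism = IsMonoidHomomorphism
  IsEmbedding    = IsMonoidMonomorphism
  IsIsomorphism  = IsMonoidIsomorphism

infix 4 _≺_

_≺_ : FiniteMonoid → FiniteMonoid → Set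
N ≺ M = ∃[ P ]
  (∃[ i ] IsEmbedding (monoid P) (monoid M) i) ×
  (∃[ h ] IsHomomorphism (monoid P) (monoid N) h × Surjective _≡_ _≡_ h)

-- Since carriers are the sets Fin n, the product is taken up to
-- isomorphism.

IsProduct : FiniteMonoid → FiniteMonoid → FiniteMonoid → Set
IsProduct M N P =
  ∃[ i ] IsIsomorphism (monoid P) (DirectProduct.monoid (monoid M) (monoid N)) i

record IsVariety (V : Pred FiniteMonoid v) : Set v where
  field
    nonempty       : ∃[ M ] M ∈ V
    ≺-closed       : ∀ {M N} → M ∈ V → N ≺ M → N ∈ V
    product-closed : ∀ {M N P} → M ∈ V → N ∈ V → IsProduct M N P → P ∈ V

IsGroupMonoid : Pred FiniteMonoid 0ℓ
IsGroupMonoid M = ∃[ inv ] IsGroup _≡_ _∙_ ε inv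
  where open FiniteMonoid M

Recognizes : FiniteMonoid → Language k → Set
Recognizes {k} M L = ∃[ h ] IsMonoidHomomorphism h ×
  (∃[ P ] ∀ w → w ∈ L ⇔ h w ∈ₛ P)
  where open MonoidMorphisms (++-[]-rawMonoid (Fin k)) (Monoid.rawMonoid (monoid M))

EquivalentTo : Pred (Sentence S) f → Pred FiniteMonoid v → Set (lsuc 0ℓ ⊔ f ⊔ v)
EquivalentTo F V = ∀ {k} (L : Language k) →
  Definable F L ⇔ (∃[ M ] M ∈ V × Recognizes M L)

------------------------------------------------------------------------
-- Syntactic monoid and stability index

module Syntactic (L : Language k) where

  infix 4 _∼_

  _∼_ : Rel (Word k) 0ℓ
  u ∼ v = ∀ x y → (x ++ u ++ y) ∈ L ⇔ (x ++ v ++ y) ∈ L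

  private
    module ⇔ = IsEquivalence (⇔-isEquivalence {ℓ = 0ℓ})

    ≡⇒⇔ : ∀ {u v} → u ≡ v → u ∈ L ⇔ v ∈ L
    ≡⇒⇔ refl = ⇔.refl

    ≡⇒∼ : ∀ {u v} → u ≡ v → u ∼ v
    ≡⇒∼ refl x y = ⇔.refl

    ∼-isEquivalence : IsEquivalence _∼_
    ∼-isEquivalence = record
      { refl  = λ x y → ⇔.refl
      ; sym   = λ e x y → ⇔.sym (e x y)
      ; trans = λ e e′ x y → ⇔.trans (e x y) (e′ x y)
      }

    ∼-cong : ∀ {u u′ v v′} → u ∼ u′ → v ∼ v′ → (u ++ v) ∼ (u′ ++ v′)
    ∼-cong {u} {u′} {v} {v′} e e′ x y =
      ⇔.trans (≡⇒⇔ (cong (x ++_) (++-assoc u v y)))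
      (⇔.trans (e x (v ++ y))
      (⇔.trans (≡⇒⇔ (sym (++-assoc x u′ (v ++ y))))
      (⇔.trans (e′ (x ++ u′) y)
      (⇔.trans (≡⇒⇔ (++-assoc x u′ (v′ ++ y)))
               (≡⇒⇔ (cong (x ++_) (sym (++-assoc u′ v′ y))))))))

  -- The quotient of the free monoid by _∼_, as a setoid monoid.

  syntacticMonoid : Monoid 0ℓ 0ℓ
  syntacticMonoid = record
    { Carrier  = Word k
    ; _≈_      = _∼_
    ; _∙_      = _++_
    ; ε        = []
    ; isMonoid = record
      { isSemigroup = record
        { isMagma = record { isEquivalence = ∼-isEquivalence ; ∙-cong = ∼-cong }
        ; assoc   = λ u v w → ≡⇒∼ (++-assoc u v w)
        }
      ; identity = (λ u → ≡⇒∼ refl) , (λ u → ≡⇒∼ (++-identityʳ u))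
      }
    }

  open Monoid syntacticMonoid using (Carrier; _≈_)

  η : Word k → Carrier
  η = id

  imageOfLength : ℕ → Pred Carrier 0ℓ
  imageOfLength n m = ∃[ u ] length u ≡ n × η u ≈ m

  Stable : ℕ → Set
  Stable s = imageOfLength s ≐ imageOfLength (2 * s)

record IsStabilityIndex (L : Language k) (s : ℕ) : Set where
  open Syntactic L
  field
    positive : 1 ≤ s
    stable   : Stable s
    least    : ∀ {t} → 1 ≤ t → Stable t → s ≤ t

{-# OPTIONS --safe #-}

-- A formula φ of the enriched fragment becomes a formula of the fragment once
-- every letter records a bounded window and its position modulo d, and the
-- constants are fixed by a case distinction.  So w ⊨ φ is read off a product, in
-- a monoid of V, of values of the positions of w that depend only on windows and
-- positions modulo d; conversely all such products are definable.  Products may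
-- be computed block by block, and the value of a block may be put on its first
-- letter.  Hence L is definable with +1 and MOD^s if and only if, for all words y
-- shorter than s, { u | u y ∈ L } is definable with +1 as a language of words u
-- over the alphabet of blocks of length s.  If s is stable, every block of length
-- s is syntactically equivalent to one of length m s, so this already follows
-- from definability of L with any moduli dividing m s.  An automaton yields some
-- stable s, and leaves finitely many languages { u | u y ∈ L } to be decided.

module Submission where

open import Defs
open import Algebra.Bundles using (Monoid)
open import Algebra.Morphism.Structures using (module MonoidMorphisms)
open import Algebra.Structures using (IsMonoid)
open import Data.Bool.Base using (Bool; true; false; T; if_then_else_)
open import Data.Empty using (⊥-elim)
open import Data.Fin.Base
  using (Fin; zero; suc; toℕ; fromℕ<; cast; combine; remQuot; finToFun; funToFin)
import Data.Fin.Properties as Fin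
open import Data.Fin.Properties
  using (all?; any?; cast-is-id; finToFun-funToFin; funToFin-finToFin; nonZeroIndex;
    pigeonhole; remQuot-combine; toℕ-fromℕ<; toℕ-injective; toℕ<n)
open import Data.Fin.Subset using (Subset; ⁅_⁆; _∪_; ⋃) renaming (_∈_ to _∈ₛ_; ⊥ to ∅ₛ)
open import Data.Fin.Subset.Properties using (_∈?_; ∪-idem; ∪-identityʳ)
open import Data.List.Base
  using (List; []; _∷_; _++_; length; lookup; take; drop; reverse; tabulate; foldr;
    foldl; concatMap)
open import Data.List.Properties
  using (++-assoc; ++-identityʳ; concatMap-++; foldl-++; length-++; length-drop;
    length-reverse; length-tabulate; length-take; lookup-tabulate; reverse-++;
    reverse-injective; reverse-involutive; tabulate-cong; tabulate-lookup;
    take++drop≡id; take-all; take-drop; take-take; unfold-reverse; ≡-dec)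
open import Data.Nat.Base
  using (ℕ; zero; suc; _+_; _*_; _∸_; _^_; _%_; _!; _≤_; _<_; _⊔_; NonZero; z≤n; s≤s;
    >-nonZero; >-nonZero⁻¹; ≢-nonZero⁻¹)
open import Data.Nat.DivMod
  using ([m+n]%n≡m%n; %-remove-+ˡ; m%n%n≡m%n; m%n<n; m<n⇒m%n≡m; m∣n⇒o%n%m≡o%m; n%1≡0)
open import Data.Nat.Divisibility using (_∣_; ∣-refl; ∣-trans; m∣m*n; m≤n⇒m!∣n!; n∣m*n)
open import Data.Nat.Properties
  using (_≟_; _<?_; _≤?_; *-identityʳ; *-monoʳ-≤; +-assoc; +-cancelʳ-≡; +-comm;
    +-identityʳ; +-monoˡ-≤; +-suc; <-trans; <⇒≢; <⇒≤; m*n≢0; m+[n∸m]≡n; m+n∸m≡n;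
    m<n⇒0<n∸m; m≤m+n; m≤m⊔n; m≤n+m; m≤n⇒m≤1+n; m≤n⇒m⊓n≡m; m≤n⊔m; m⊓n≤m; m⊓n≤n; n<1+n;
    n≤1+n; suc-injective; ∸-mono; ≤-<-trans; ≤-refl; ≤-trans; ≮⇒≥; ≰⇒>; _!≢0)
open import Data.Product.Base using (∃-syntax; _×_; _,_; proj₁; proj₂)
open import Data.Product.Function.NonDependent.Propositional using (_×-⇔_)
open import Data.Sum.Base using (_⊎_; inj₁; inj₂)
open import Data.Sum.Function.Propositional using (_⊎-⇔_)
import Data.Vec.Base as Vec
open Vec using (Vec; []; _∷_)
open import Data.Vec.Properties using ([]=⇒lookup; lookup⇒[]=; lookup∘tabulate)
open import Function.Base using (_∘_; id)
open import Function.Bundles using (_⇔_; mk⇔; Equivalence)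
open import Function.Properties.Equivalence using (⇔-isEquivalence)
open import Level using (Level)
open import Relation.Binary.Construct.Closure.ReflexiveTransitive
  using (Star; _◅_; _◅◅_; gmap) renaming (ε to ε*)
open import Relation.Binary.PropositionalEquality
open import Relation.Binary.Structures using (IsEquivalence)
open import Relation.Nullary using (¬_; Dec; yes; no; does; _×-dec_)
open import Relation.Nullary.Decidable using (map′)
open import Relation.Nullary.Negation using (contradiction)
open import Relation.Unary using (Pred; _∈_; _⊆_; U)

open Equivalence using (to; from)
open Signature

-- Formulas cannot be carried directly from a word to its word of blocks, or back: the quantifiers
-- would range over a different set of positions. Products in a monoid can be regrouped, so every
-- such change goes through `Recogniser`, and `EquivalentTo` is used in both directions: once to
-- turn a formula into a product, once to turn the regrouped product into a formula. A fragment is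
-- known only through its closure properties, so formulas are rewritten only at letters and atoms,
-- keeping the free variables of each. A constant has no variable from which a letter could be read,
-- so its truth value must be the same for all words under consideration. Hence the work is done on
-- classes of words with prescribed ends, and the classes are glued together by quantifier-free
-- sentences. Definability ignores the empty word, and the empty word of blocks corresponds to words
-- shorter than `s`: these are finite in number and are treated one by one.

module ⇔ {ℓ : Level} = IsEquivalence (⇔-isEquivalence {ℓ = ℓ})

-- A quantifier-free formula with prescribed free variables: what may be put
-- in the place of a letter predicate or of an atom.

record Leaf (S : Signature) (p q : ℕ) (s : Subset p) : Set where
  field
    formula : Formula S p q
    qf      : QuantifierFree formula
    free₁≡  : free₁ formula ≡ s
    free₂≡  : free₂ formula ≡ ∅ₛ

open Leaf

record Valuation (p q : ℕ) : Set where
  constructor ⟨_,_,_⟩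
  field
    {size} : ℕ
    label  : Labelling size
    first  : Vec (Fin size) p
    second : Vec (Subset size) q

module _ {S : Signature} {p q : ℕ} {s : Subset p} where

  ¬ᴸ_ : Leaf S p q s → Leaf S p q s
  ¬ᴸ L = record
    { formula = ¬′ formula L ; qf = ¬′ qf L ; free₁≡ = free₁≡ L ; free₂≡ = free₂≡ L }

  infixr 7 _∧ᴸ_
  infixr 6 _∨ᴸ_

  _∧ᴸ_ _∨ᴸ_ : Leaf S p q s → Leaf S p q s → Leaf S p q s
  L ∧ᴸ L′ = record
    { formula = formula L ∧′ formula L′
    ; qf      = qf L ∧′ qf L′
    ; free₁≡  = trans (cong₂ _∪_ (free₁≡ L) (free₁≡ L′)) (∪-idem _)
    ; free₂≡  = trans (cong₂ _∪_ (free₂≡ L) (free₂≡ L′)) (∪-idem _)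
    }
  L ∨ᴸ L′ = record
    { formula = formula L ∨′ formula L′
    ; qf      = qf L ∨′ qf L′
    ; free₁≡  = trans (cong₂ _∪_ (free₁≡ L) (free₁≡ L′)) (∪-idem _)
    ; free₂≡  = trans (cong₂ _∪_ (free₂≡ L) (free₂≡ L′)) (∪-idem _)
    }

  -- The first argument only serves to provide the free variables.

  const : Leaf S p q s → Bool → Leaf S p q s
  const L false = L ∧ᴸ ¬ᴸ L
  const L true  = ¬ᴸ (L ∧ᴸ ¬ᴸ L)

  ⋁ : Leaf S p q s → (m : ℕ) → (Fin m → Leaf S p q s) → Leaf S p q s
  ⋁ L zero    F = const L false
  ⋁ L (suc m) F = F zero ∨ᴸ ⋁ L m (F ∘ suc)

  infix 4 _⊩_

  _⊩_ : Valuation p q → Leaf S p q s → Set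
  ⟨ ℓ , ρ , θ ⟩ ⊩ L = Sat ℓ ρ θ (formula L)

  const-⊩ : ∀ v L b → v ⊩ const L b ⇔ T b
  const-⊩ v L false = mk⇔ (λ (a , b) → b a) (λ ())
  const-⊩ v L true  = mk⇔ _ (λ _ (a , b) → b a)

  ⋁-⊩ : ∀ v L m F → v ⊩ ⋁ L m F ⇔ (∃[ i ] v ⊩ F i)
  ⋁-⊩ v L zero F = mk⇔ (λ (a , b) → ⊥-elim (b a)) (λ ())
  ⋁-⊩ v L (suc m) F = mk⇔
    (λ { (inj₁ x) → zero , x ; (inj₂ y) → let (i , z) = to (⋁-⊩ v L m (F ∘ suc)) y in suc i , z })
    (λ { (zero , x) → inj₁ x ; (suc i , z) → inj₂ (from (⋁-⊩ v L m (F ∘ suc)) (i , z)) })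

-- The letter 0 is arbitrary: this leaf is only passed on as a carrier of the free variable `x`.
fresh : ∀ {S p q} (x : Fin p) → Leaf S p q ⁅ x ⁆
fresh x = record { formula = letter 0 x ; qf = letter 0 x ; free₁≡ = refl ; free₂≡ = refl }

letterᴸ : ∀ {S p q} → Letter → (x : Fin p) → Leaf S p q ⁅ x ⁆
letterᴸ a x = record { formula = letter a x ; qf = letter a x ; free₁≡ = refl ; free₂≡ = refl }

⋃⁅_⁆ : ∀ {p r} → Vec (Fin p) r → Subset p
⋃⁅ xs ⁆ = ⋃ (Vec.toList (Vec.map ⁅_⁆ xs))

atomᴸ : ∀ {S p q r} → Symbol S r → (xs : Vec (Fin p) r) → Leaf S p q ⋃⁅ xs ⁆
atomᴸ R xs = record { formula = atom R xs ; qf = atom R xs ; free₁≡ = refl ; free₂≡ = refl }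

-- Translations that act on letters and atoms

record Translation (S S′ : Signature) : Set where
  field
    onLetter : ∀ {p q} → Letter → (x : Fin p) → Leaf S′ p q ⁅ x ⁆
    onAtom   : ∀ {p q r} → Symbol S r → (xs : Vec (Fin p) r) → Leaf S′ p q ⋃⁅ xs ⁆

  translate : ∀ {p q} → Formula S p q → Formula S′ p q
  translate ⊤′           = ⊤′
  translate ⊥′           = ⊥′
  translate (letter a x) = formula (onLetter a x)
  translate (atom R xs)  = formula (onAtom R xs)
  translate (x ∈′ X)     = x ∈′ X
  translate (¬′ φ)       = ¬′ translate φ
  translate (φ ∧′ ψ)     = translate φ ∧′ translate ψ
  translate (φ ∨′ ψ)     = translate φ ∨′ translate ψ
  translate (∃₁ φ)       = ∃₁ (translate φ)
  translate (∀₁ φ)       = ∀₁ (translate φ)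
  translate (∃₂ φ)       = ∃₂ (translate φ)
  translate (∀₂ φ)       = ∀₂ (translate φ)

  translate-qf : ∀ {p q} {φ : Formula S p q} → QuantifierFree φ → QuantifierFree (translate φ)
  translate-qf ⊤′           = ⊤′
  translate-qf ⊥′           = ⊥′
  translate-qf (letter a x) = qf (onLetter a x)
  translate-qf (atom R xs)  = qf (onAtom R xs)
  translate-qf (x ∈′ X)     = x ∈′ X
  translate-qf (¬′ φ)       = ¬′ translate-qf φ
  translate-qf (φ ∧′ ψ)     = translate-qf φ ∧′ translate-qf ψ
  translate-qf (φ ∨′ ψ)     = translate-qf φ ∨′ translate-qf ψ

  translate-free₁ : ∀ {p q} (φ : Formula S p q) → free₁ (translate φ) ≡ free₁ φ
  translate-free₁ ⊤′           = refl
  translate-free₁ ⊥′           = refl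
  translate-free₁ (letter a x) = free₁≡ (onLetter a x)
  translate-free₁ (atom R xs)  = free₁≡ (onAtom R xs)
  translate-free₁ (x ∈′ X)     = refl
  translate-free₁ (¬′ φ)       = translate-free₁ φ
  translate-free₁ (φ ∧′ ψ)     = cong₂ _∪_ (translate-free₁ φ) (translate-free₁ ψ)
  translate-free₁ (φ ∨′ ψ)     = cong₂ _∪_ (translate-free₁ φ) (translate-free₁ ψ)
  translate-free₁ (∃₁ φ)       = cong Vec.tail (translate-free₁ φ)
  translate-free₁ (∀₁ φ)       = cong Vec.tail (translate-free₁ φ)
  translate-free₁ (∃₂ φ)       = translate-free₁ φ
  translate-free₁ (∀₂ φ)       = translate-free₁ φ

  translate-free₂ : ∀ {p q} (φ : Formula S p q) → free₂ (translate φ) ≡ free₂ φ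
  translate-free₂ ⊤′           = refl
  translate-free₂ ⊥′           = refl
  translate-free₂ (letter a x) = free₂≡ (onLetter a x)
  translate-free₂ (atom R xs)  = free₂≡ (onAtom R xs)
  translate-free₂ (x ∈′ X)     = refl
  translate-free₂ (¬′ φ)       = translate-free₂ φ
  translate-free₂ (φ ∧′ ψ)     = cong₂ _∪_ (translate-free₂ φ) (translate-free₂ ψ)
  translate-free₂ (φ ∨′ ψ)     = cong₂ _∪_ (translate-free₂ φ) (translate-free₂ ψ)
  translate-free₂ (∃₁ φ)       = translate-free₂ φ
  translate-free₂ (∀₁ φ)       = translate-free₂ φ
  translate-free₂ (∃₂ φ)       = cong Vec.tail (translate-free₂ φ)
  translate-free₂ (∀₂ φ)       = cong Vec.tail (translate-free₂ φ)

  -- `replace` asks for equal free variables before and after; translation leaves them unchanged, so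
  -- the requirement survives. A derivation in an enrichment can therefore be replayed after
  -- translation.
  translate-⇝ : ∀ {p q} {φ φ′ : Formula S p q} → φ ⇝ φ′ → translate φ ⇝ translate φ′
  translate-⇝ (replace {ψ} {ψ′} a b e e′) = replace (translate-qf a) (translate-qf b)
    (trans (translate-free₁ ψ) (trans e (sym (translate-free₁ ψ′))))
    (trans (translate-free₂ ψ) (trans e′ (sym (translate-free₂ ψ′))))
  translate-⇝ (in-¬ t)  = in-¬ (translate-⇝ t)
  translate-⇝ (in-∧ˡ t) = in-∧ˡ (translate-⇝ t)
  translate-⇝ (in-∧ʳ t) = in-∧ʳ (translate-⇝ t)
  translate-⇝ (in-∨ˡ t) = in-∨ˡ (translate-⇝ t)
  translate-⇝ (in-∨ʳ t) = in-∨ʳ (translate-⇝ t)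
  translate-⇝ (in-∃₁ t) = in-∃₁ (translate-⇝ t)
  translate-⇝ (in-∀₁ t) = in-∀₁ (translate-⇝ t)
  translate-⇝ (in-∃₂ t) = in-∃₂ (translate-⇝ t)
  translate-⇝ (in-∀₂ t) = in-∀₂ (translate-⇝ t)

open Translation

infix 4 _⇝*_

_⇝*_ : ∀ {S p q} → Formula S p q → Formula S p q → Set
_⇝*_ = Star _⇝_

module _ {S : Signature} {p q : ℕ} where

  ∧-⇝* : {φ φ′ ψ ψ′ : Formula S p q} → φ ⇝* φ′ → ψ ⇝* ψ′ → φ ∧′ ψ ⇝* φ′ ∧′ ψ′
  ∧-⇝* a b = gmap (_∧′ _) in-∧ˡ a ◅◅ gmap (_ ∧′_) in-∧ʳ b

  ∨-⇝* : {φ φ′ ψ ψ′ : Formula S p q} → φ ⇝* φ′ → ψ ⇝* ψ′ → φ ∨′ ψ ⇝* φ′ ∨′ ψ′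
  ∨-⇝* a b = gmap (_∨′ _) in-∨ˡ a ◅◅ gmap (_ ∨′_) in-∨ʳ b

  leaf-⇝* : ∀ {s} (L L′ : Leaf S p q s) → formula L ⇝* formula L′
  leaf-⇝* L L′ = replace (qf L) (qf L′) (trans (free₁≡ L) (sym (free₁≡ L′)))
                         (trans (free₂≡ L) (sym (free₂≡ L′))) ◅ ε*

-- Each leaf is exchanged in one step, so a translation is itself a chain of quantifier-free
-- substitutions; this puts the translations of sentences of a fragment into its enrichment.
embed-⇝* : ∀ {S S′ p q} (τ : Translation S (S ⊕ S′)) (φ : Formula S p q) →
           embed φ ⇝* translate τ φ
embed-⇝* τ ⊤′           = ε*
embed-⇝* τ ⊥′           = ε*
embed-⇝* τ (letter a x) = leaf-⇝* (letterᴸ a x) (onLetter τ a x)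
embed-⇝* τ (atom R xs)  = leaf-⇝* (atomᴸ (inj₁ R) xs) (onAtom τ R xs)
embed-⇝* τ (x ∈′ X)     = ε*
embed-⇝* τ (¬′ φ)       = gmap ¬′_ in-¬ (embed-⇝* τ φ)
embed-⇝* τ (φ ∧′ ψ)     = ∧-⇝* (embed-⇝* τ φ) (embed-⇝* τ ψ)
embed-⇝* τ (φ ∨′ ψ)     = ∨-⇝* (embed-⇝* τ φ) (embed-⇝* τ ψ)
embed-⇝* τ (∃₁ φ)       = gmap ∃₁ in-∃₁ (embed-⇝* τ φ)
embed-⇝* τ (∀₁ φ)       = gmap ∀₁ in-∀₁ (embed-⇝* τ φ)
embed-⇝* τ (∃₂ φ)       = gmap ∃₂ in-∃₂ (embed-⇝* τ φ)
embed-⇝* τ (∀₂ φ)       = gmap ∀₂ in-∀₂ (embed-⇝* τ φ)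

⇝*-translate : ∀ {S p q} (τ : Translation S S) (φ : Formula S p q) → φ ⇝* translate τ φ
⇝*-translate τ ⊤′           = ε*
⇝*-translate τ ⊥′           = ε*
⇝*-translate τ (letter a x) = leaf-⇝* (letterᴸ a x) (onLetter τ a x)
⇝*-translate τ (atom R xs)  = leaf-⇝* (atomᴸ R xs) (onAtom τ R xs)
⇝*-translate τ (x ∈′ X)     = ε*
⇝*-translate τ (¬′ φ)       = gmap ¬′_ in-¬ (⇝*-translate τ φ)
⇝*-translate τ (φ ∧′ ψ)     = ∧-⇝* (⇝*-translate τ φ) (⇝*-translate τ ψ)
⇝*-translate τ (φ ∨′ ψ)     = ∨-⇝* (⇝*-translate τ φ) (⇝*-translate τ ψ)
⇝*-translate τ (∃₁ φ)       = gmap ∃₁ in-∃₁ (⇝*-translate τ φ)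
⇝*-translate τ (∀₁ φ)       = gmap ∀₁ in-∀₁ (⇝*-translate τ φ)
⇝*-translate τ (∃₂ φ)       = gmap ∃₂ in-∃₂ (⇝*-translate τ φ)
⇝*-translate τ (∀₂ φ)       = gmap ∀₂ in-∀₂ (⇝*-translate τ φ)

restrict : ∀ {S S′ S″} → Translation (S ⊕ S′) S″ → Translation S S″
restrict τ = record { onLetter = onLetter τ ; onAtom = λ R → onAtom τ (inj₁ R) }

translate-embed : ∀ {S S′ S″ p q} (τ : Translation (S ⊕ S′) S″) (φ : Formula S p q) →
                  translate (restrict τ) φ ≡ translate τ (embed φ)
translate-embed τ ⊤′           = refl
translate-embed τ ⊥′           = refl
translate-embed τ (letter a x) = refl
translate-embed τ (atom R xs)  = refl
translate-embed τ (x ∈′ X)     = refl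
translate-embed τ (¬′ φ)       = cong ¬′_ (translate-embed τ φ)
translate-embed τ (φ ∧′ ψ)     = cong₂ _∧′_ (translate-embed τ φ) (translate-embed τ ψ)
translate-embed τ (φ ∨′ ψ)     = cong₂ _∨′_ (translate-embed τ φ) (translate-embed τ ψ)
translate-embed τ (∃₁ φ)       = cong ∃₁ (translate-embed τ φ)
translate-embed τ (∀₁ φ)       = cong ∀₁ (translate-embed τ φ)
translate-embed τ (∃₂ φ)       = cong ∃₂ (translate-embed τ φ)
translate-embed τ (∀₂ φ)       = cong ∀₂ (translate-embed τ φ)

module _ {S : Signature} (weight : ∀ {r} → Symbol S r → ℕ) where

  bound : ∀ {p q} → Formula S p q → ℕ
  bound ⊤′           = 0
  bound ⊥′           = 0
  bound (letter a x) = 0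
  bound (atom R xs)  = weight R
  bound (x ∈′ X)     = 0
  bound (¬′ φ)       = bound φ
  bound (φ ∧′ ψ)     = bound φ ⊔ bound ψ
  bound (φ ∨′ ψ)     = bound φ ⊔ bound ψ
  bound (∃₁ φ)       = bound φ
  bound (∀₁ φ)       = bound φ
  bound (∃₂ φ)       = bound φ
  bound (∀₂ φ)       = bound φ

¬-⇔ : {A B : Set} → A ⇔ B → (¬ A) ⇔ (¬ B)
¬-⇔ e = mk⇔ (_∘ from e) (_∘ to e)

∃-⇔ : {I : Set} {A B : I → Set} → (∀ i → A i ⇔ B i) → (∃[ i ] A i) ⇔ (∃[ i ] B i)
∃-⇔ e = mk⇔ (λ (i , a) → i , to (e i) a) (λ (i , b) → i , from (e i) b)

∀-⇔ : {I : Set} {A B : I → Set} → (∀ i → A i ⇔ B i) → (∀ i → A i) ⇔ (∀ i → B i)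
∀-⇔ e = mk⇔ (λ f i → to (e i) (f i)) (λ f i → from (e i) (f i))

-- Windows and moduli are unbounded in the enriched signatures but bounded by
-- some N in each formula; only the symbols within N need a faithful translation.

module _ {S S′ : Signature} (τ : Translation S S′) (weight : ∀ {r} → Symbol S r → ℕ) (N : ℕ)
         {n : ℕ} (ℓ ℓ′ : Labelling n)
         (letter-sat : ∀ {p q} a x (ρ : Vec (Fin n) p) (θ : Vec (Subset n) q) →
            Sat {S = S} ℓ ρ θ (letter a x) ⇔ Sat ℓ′ ρ θ (formula (onLetter τ a x)))
         (atom-sat : ∀ {p q r} (R : Symbol S r) xs (ρ : Vec (Fin n) p) (θ : Vec (Subset n) q) →
            weight R ≤ N → Sat {S = S} ℓ ρ θ (atom R xs) ⇔ Sat ℓ′ ρ θ (formula (onAtom τ R xs))) where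

  translate-sat : ∀ {p q} (φ : Formula S p q) (ρ : Vec (Fin n) p) (θ : Vec (Subset n) q) →
                  bound weight φ ≤ N → Sat ℓ ρ θ φ ⇔ Sat ℓ′ ρ θ (translate τ φ)
  translate-sat ⊤′           ρ θ _ = ⇔.refl
  translate-sat ⊥′           ρ θ _ = ⇔.refl
  translate-sat (letter a x) ρ θ _ = letter-sat a x ρ θ
  translate-sat (atom R xs)  ρ θ b = atom-sat R xs ρ θ b
  translate-sat (x ∈′ X)     ρ θ _ = ⇔.refl
  translate-sat (¬′ φ)       ρ θ b = ¬-⇔ (translate-sat φ ρ θ b)
  translate-sat (φ ∧′ ψ)     ρ θ b =
    translate-sat φ ρ θ (≤-trans (m≤m⊔n _ _) b) ×-⇔ translate-sat ψ ρ θ (≤-trans (m≤n⊔m _ _) b)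
  translate-sat (φ ∨′ ψ)     ρ θ b =
    translate-sat φ ρ θ (≤-trans (m≤m⊔n _ _) b) ⊎-⇔ translate-sat ψ ρ θ (≤-trans (m≤n⊔m _ _) b)
  translate-sat (∃₁ φ)       ρ θ b = ∃-⇔ λ x → translate-sat φ (x ∷ ρ) θ b
  translate-sat (∀₁ φ)       ρ θ b = ∀-⇔ λ x → translate-sat φ (x ∷ ρ) θ b
  translate-sat (∃₂ φ)       ρ θ b = ∃-⇔ λ X → translate-sat φ ρ (X ∷ θ) b
  translate-sat (∀₂ φ)       ρ θ b = ∀-⇔ λ X → translate-sat φ ρ (X ∷ θ) b

-- Membership in fragments and enrichments

module _ {f : Level} {S : Signature} {F : Pred (Sentence S) f} (isFragment : IsFragment F) where
  open IsFragment isFragment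

  ⇝*-closed : ∀ {φ φ′} → φ ∈ F → φ ⇝* φ′ → φ′ ∈ F
  ⇝*-closed φ∈F ε*       = φ∈F
  ⇝*-closed φ∈F (t ◅ ts) = ⇝*-closed (⇝-closed φ∈F t) ts

  Enrich-isFragment : ∀ {S′} → IsFragment (Enrich F S′)
  Enrich-isFragment = record
    -- A sentence has no free variables, so any quantifier-free sentence may replace `⊤′`.
    { quantifier-free = λ q → substitute (base (quantifier-free ⊤′)) (replace ⊤′ q (unique _ _) (unique _ _))
    ; ∧-closed        = conj
    ; ∨-closed        = disj
    ; ⇝-closed        = substitute
    }
    where
    unique : (s t : Subset 0) → s ≡ t
    unique [] [] = refl

    conj : ∀ {S′} {φ ψ : Sentence (S ⊕ S′)} → φ ∈ Enrich F S′ → ψ ∈ Enrich F S′ → φ ∧′ ψ ∈ Enrich F S′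
    conj (base a)         (base b)         = base (∧-closed a b)
    conj (base a)         (substitute b t) = substitute (conj (base a) b) (in-∧ʳ t)
    conj (substitute a t) b                = substitute (conj a b) (in-∧ˡ t)

    disj : ∀ {S′} {φ ψ : Sentence (S ⊕ S′)} → φ ∈ Enrich F S′ → ψ ∈ Enrich F S′ → φ ∨′ ψ ∈ Enrich F S′
    disj (base a)         (base b)         = base (∨-closed a b)
    disj (base a)         (substitute b t) = substitute (disj (base a) b) (in-∨ʳ t)
    disj (substitute a t) b                = substitute (disj a b) (in-∨ˡ t)

  -- Induction on the derivation: a base sentence reaches its translation by substitutions inside
  -- `F`, and the later substitutions are translated into substitutions.
  Enrich⇒F : ∀ {S′ φ} (τ : Translation (S ⊕ S′) S) → φ ∈ Enrich F S′ → translate τ φ ∈ F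
  Enrich⇒F τ (base {φ} φ∈F)   = subst (_∈ F) (translate-embed τ φ)
                                  (⇝*-closed φ∈F (⇝*-translate (restrict τ) φ))
  Enrich⇒F τ (substitute e t) = ⇝-closed (Enrich⇒F τ e) (translate-⇝ τ t)

F⇒Enrich : ∀ {f S S′} {F : Pred (Sentence S) f} {φ} (τ : Translation S (S ⊕ S′)) →
           φ ∈ F → translate τ φ ∈ Enrich F S′
F⇒Enrich {F = F} {φ} τ φ∈F = go (base φ∈F) (embed-⇝* τ φ)
  where
  go : ∀ {φ φ′} → φ ∈ Enrich F _ → φ ⇝* φ′ → φ′ ∈ Enrich F _
  go e ε*       = e
  go e (t ◅ ts) = go (substitute e t) ts

Enrich⇒Enrich : ∀ {f S S′ S″} {F : Pred (Sentence S) f} {φ} (τ : Translation (S ⊕ S′) (S ⊕ S″)) →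
                φ ∈ Enrich F S′ → translate τ φ ∈ Enrich F S″
Enrich⇒Enrich {S″ = S″} {F} τ (base {φ} φ∈F) =
  subst (_∈ Enrich F S″) (translate-embed τ φ) (F⇒Enrich (restrict τ) φ∈F)
Enrich⇒Enrich τ (substitute e t) = substitute (Enrich⇒Enrich τ e) (translate-⇝ τ t)

-- Reading letters

T-does : {A : Set} (d : Dec A) → T (does d) ⇔ A
T-does (yes a) = mk⇔ (λ _ → a) _
T-does (no ¬a) = mk⇔ (λ ()) ¬a

labels : ∀ {k} (w : Word k) → Labelling (length w)
labels w = toℕ ∘ lookup w

module _ {k : ℕ} where

  -- False beyond the end of the word, matching the convention of `localInterp` for positions that
  -- do not exist.
  hasLetter : Letter → Word k → ℕ → Bool
  hasLetter a []      j       = false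
  hasLetter a (b ∷ w) zero    = does (toℕ b ≟ a)
  hasLetter a (b ∷ w) (suc j) = hasLetter a w j

  hasLetter-lookup : ∀ a w j →
    T (hasLetter a w j) ⇔ (∃[ y ] toℕ y ≡ j × labels w y ≡ a)
  hasLetter-lookup a []      j       = mk⇔ (λ ()) (λ ())
  hasLetter-lookup a (b ∷ w) zero    = mk⇔
    (λ t → zero , refl , to (T-does (toℕ b ≟ a)) t)
    (λ { (zero , _ , e) → from (T-does (toℕ b ≟ a)) e })
  hasLetter-lookup a (b ∷ w) (suc j) = mk⇔
    (λ t → let (y , e , e′) = to (hasLetter-lookup a w j) t in suc y , cong suc e , e′)
    (λ { (suc y , e , e′) → from (hasLetter-lookup a w j) (y , suc-injective e , e′) })

  hasLetter-drop : ∀ a i w j → hasLetter a (drop i w) j ≡ hasLetter a w (i + j)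
  hasLetter-drop a zero    w       j = refl
  hasLetter-drop a (suc i) []      j = refl
  hasLetter-drop a (suc i) (b ∷ w) j = hasLetter-drop a i w j

  hasLetter-take : ∀ a N w j → j < N → hasLetter a (take N w) j ≡ hasLetter a w j
  hasLetter-take a (suc N) []      j       _         = refl
  hasLetter-take a (suc N) (b ∷ w) zero    _         = refl
  hasLetter-take a (suc N) (b ∷ w) (suc j) (s≤s j<N) = hasLetter-take a N w j j<N

  -- Formulated with a factorisation because reversal merely exchanges (and reverses) the two outer
  -- factors.
  hasLetter-split : ∀ a w j →
    T (hasLetter a w j) ⇔ (∃[ x ] ∃[ b ] ∃[ y ] w ≡ x ++ b ∷ y × length x ≡ j × toℕ b ≡ a)
  hasLetter-split a []      j       = mk⇔ (λ ()) (λ { ([] , _ , _ , () , _) ; (_ ∷ _ , _ , _ , () , _) })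
  hasLetter-split a (b ∷ w) zero    = mk⇔
    (λ t → [] , b , w , refl , refl , to (T-does (toℕ b ≟ a)) t)
    (λ { ([] , _ , _ , refl , _ , e) → from (T-does (toℕ b ≟ a)) e })
  hasLetter-split a (b ∷ w) (suc j) = mk⇔
    (λ t → let (x , c , y , e , e′ , e″) = to (hasLetter-split a w j) t
           in b ∷ x , c , y , cong (b ∷_) e , cong suc e′ , e″)
    (λ { (_ ∷ x , c , y , refl , e′ , e″) →
         from (hasLetter-split a w j) (x , c , y , refl , suc-injective e′ , e″) })

  hasLetter-reverse : ∀ a w j →
    T (hasLetter a (reverse w) j) ⇔ (∃[ i ] suc (i + j) ≡ length w × T (hasLetter a w i))
  hasLetter-reverse a w j = mk⇔ ⇒ ⇐
    where
    reverse-split : ∀ (x : Word k) b y → reverse (x ++ b ∷ y) ≡ reverse y ++ b ∷ reverse x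
    reverse-split x b y = trans (reverse-++ x (b ∷ y))
      (trans (cong (_++ reverse x) (unfold-reverse b y)) (++-assoc (reverse y) _ _))

    ⇒ : T (hasLetter a (reverse w) j) → ∃[ i ] suc (i + j) ≡ length w × T (hasLetter a w i)
    ⇒ t with to (hasLetter-split a (reverse w) j) t
    ... | x , b , y , e , e′ , e″ =
      length (reverse y) , len , from (hasLetter-split a w _) (reverse y , b , reverse x , w≡ , refl , e″)
      where
      w≡ : w ≡ reverse y ++ b ∷ reverse x
      w≡ = trans (sym (reverse-involutive w)) (trans (cong reverse e) (reverse-split x b y))

      len : suc (length (reverse y) + j) ≡ length w
      len = trans (sym (+-suc (length (reverse y)) j))
        (trans (cong (λ i → length (reverse y) + suc i) (trans (sym e′) (sym (length-reverse x))))
        (trans (sym (length-++ (reverse y))) (cong length (sym w≡))))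

    ⇐ : (∃[ i ] suc (i + j) ≡ length w × T (hasLetter a w i)) → T (hasLetter a (reverse w) j)
    ⇐ (i , e , t) with to (hasLetter-split a w i) t
    ... | x , b , y , refl , refl , e″ = from (hasLetter-split a (reverse w) j)
      (reverse y , b , reverse x , reverse-split x b y , len , e″)
      where
      len : length (reverse y) ≡ j
      len = trans (length-reverse y) (+-cancelʳ-≡ (suc (length x)) _ _ 
        (trans (+-comm (length y) _) (trans (sym (+-suc (length x) (length y)))
        (trans (sym (length-++ x)) (trans (sym e) (+-comm (suc (length x)) j))))))

  any-sat : ∀ {P : ℕ → Set} (P? : ∀ i → Dec (P i)) a (w : Word k) →
    T (does (any? λ y → P? (toℕ y) ×-dec (labels w y ≟ a))) ⇔ (∃[ y ] P (toℕ y) × labels w y ≡ a)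
  any-sat P? a w = T-does (any? λ y → P? (toℕ y) ×-dec (labels w y ≟ a))

  at+-sat : ∀ a j (w : Word k) (x : Fin (length w)) →
    T (localInterp (letterAt+ a j) (labels w) (x ∷ [])) ⇔ T (hasLetter a (drop (toℕ x) w) j)
  at+-sat a j w x = ⇔.trans (any-sat (_≟ toℕ x + j) a w)
    (⇔.trans (⇔.sym (hasLetter-lookup a w (toℕ x + j)))
    (mk⇔ (subst T (sym (hasLetter-drop a (toℕ x) w j))) (subst T (hasLetter-drop a (toℕ x) w j))))

  min+-sat : ∀ a j (w : Word k) →
    T (localInterp (letterMin+ a j) {length w} (labels w) []) ⇔ T (hasLetter a w j)
  min+-sat a j w = ⇔.trans (any-sat (_≟ j) a w) (⇔.sym (hasLetter-lookup a w j))

  max--sat : ∀ a j (w : Word k) →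
    T (localInterp (letterMax- a j) {length w} (labels w) []) ⇔ T (hasLetter a (reverse w) j)
  max--sat a j w = ⇔.trans (any-sat (λ i → suc (i + j) ≟ length w) a w) (⇔.trans
    (mk⇔ (λ ((y , e , e′) : ∃[ y ] suc (toℕ y + j) ≡ length w × labels w y ≡ a) →
            toℕ y , e , from (hasLetter-lookup a w (toℕ y)) (y , refl , e′))
         (λ (i , e , t) → let (y , e′ , e″) = to (hasLetter-lookup a w i) t
                          in y , trans (cong (λ i → suc (i + j)) e′) e , e″))
    (⇔.sym (hasLetter-reverse a w j)))

  -- `codes r` counts the words of length at most `r`: code `zero` is the empty word, the others
  -- split off a first letter. Windows cut short by the end of the word thus have codes too.
  codes : ℕ → ℕ
  codes zero    = 1
  codes (suc r) = suc (k * codes r)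

  encode : ∀ r → Word k → Fin (codes r)
  encode zero    w       = zero
  encode (suc r) []      = zero
  encode (suc r) (a ∷ w) = suc (combine a (encode r w))

  decode : ∀ r → Fin (codes r) → Word k
  decode zero    c       = []
  decode (suc r) zero    = []
  decode (suc r) (suc c) = let (a , c′) = remQuot {k} (codes r) c in a ∷ decode r c′

  decode-encode : ∀ r w → decode r (encode r w) ≡ take r w
  decode-encode zero    w       = refl
  decode-encode (suc r) []      = refl
  decode-encode (suc r) (a ∷ w) =
    trans (cong (λ (a , c) → a ∷ decode r c) (remQuot-combine {k} a (encode r w)))
          (cong (a ∷_) (decode-encode r w))

  encode-take : ∀ r w → encode r (take r w) ≡ encode r w
  encode-take zero    w       = refl
  encode-take (suc r) []      = refl
  encode-take (suc r) (a ∷ w) = cong (λ c → suc (combine a c)) (encode-take r w)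

  -- A decision tree for h on the first r letters of the word accessed through at.

  module _ {S : Signature} {p q : ℕ} {s : Subset p} where

    tree : (r : ℕ) → (Letter → ℕ → Leaf S p q s) → (Word k → Bool) → Leaf S p q s
    tree zero    at h = const (at 0 0) (h [])
    tree (suc r) at h =
      ⋁ (at 0 0) k (λ a → at (toℕ a) 0 ∧ᴸ tree r (λ b → at b ∘ suc) (h ∘ (a ∷_))) ∨ᴸ
      -- No letter can be read here: the word has ended, and `h` is evaluated at the empty
      -- remainder.
      (¬ᴸ ⋁ (at 0 0) k (λ a → at (toℕ a) 0)) ∧ᴸ const (at 0 0) (h [])

    tree-⊩ : ∀ v (r : ℕ) at h w → (∀ a j → v ⊩ at a j ⇔ T (hasLetter a w j)) →
             v ⊩ tree r at h ⇔ T (h (take r w))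
    tree-⊩ v zero    at h w  at-⊩ = const-⊩ v (at 0 0) (h [])
    tree-⊩ v (suc r) at h w at-⊩ = go w at-⊩
      where
      first : Fin k → Leaf S p q s
      first a = at (toℕ a) 0

      branch : Fin k → Leaf S p q s
      branch a = first a ∧ᴸ tree r (λ b → at b ∘ suc) (h ∘ (a ∷_))

      some : ∀ F → v ⊩ ⋁ (at 0 0) k F ⇔ (∃[ a ] v ⊩ F a)
      some = ⋁-⊩ v (at 0 0) k

      go : ∀ w → (∀ a j → v ⊩ at a j ⇔ T (hasLetter a w j)) →
           v ⊩ tree (suc r) at h ⇔ T (h (take (suc r) w))
      go [] at-⊩ = mk⇔
        (λ { (inj₁ t) → let (a , u , _) = to (some branch) t in ⊥-elim (to (at-⊩ (toℕ a) 0) u)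
           ; (inj₂ (_ , t)) → to (const-⊩ v (at 0 0) (h [])) t })
        (λ t → inj₂ ( (λ u → let (a , u′) = to (some first) u in to (at-⊩ (toℕ a) 0) u′)
                    , from (const-⊩ v (at 0 0) (h [])) t))
      go (b ∷ w) at-⊩ = mk⇔
        (λ { (inj₁ t) → let (a , u , t′) = to (some branch) t
                            b≡a = toℕ-injective (to (T-does (toℕ b ≟ toℕ a)) (to (at-⊩ (toℕ a) 0) u))
                        in subst (λ c → T (h (c ∷ take r w))) (sym b≡a) (to (rest a) t′)
           ; (inj₂ (n , _)) → ⊥-elim (n (from (some first) (b , here))) })
        (λ t → inj₁ (from (some branch) (b , here , from (rest b) t)))
        where
        here : v ⊩ first b
        here = from (at-⊩ (toℕ b) 0) (from (T-does (toℕ b ≟ toℕ b)) refl)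

        rest : ∀ a → v ⊩ tree r (λ b → at b ∘ suc) (h ∘ (a ∷_)) ⇔ T (h (a ∷ take r w))
        rest a = tree-⊩ v r (λ b → at b ∘ suc) (h ∘ (a ∷_)) w (λ a j → at-⊩ a (suc j))

-- Formulas and windowed products

≡⇒⇔ : {A B : Set} → A ≡ B → A ⇔ B
≡⇒⇔ refl = ⇔.refl

weaken : ∀ {S p q} {s s′ : Subset p} → s ≡ s′ → Leaf S p q s → Leaf S p q s′
weaken e L = record
  { formula = formula L ; qf = qf L ; free₁≡ = trans (free₁≡ L) e ; free₂≡ = free₂≡ L }

-- f i w is the value of a position i from which on the word reads w.

Windowed : ∀ {k} {A : Set} (r d : ℕ) .{{_ : NonZero d}} → (ℕ → Word k → A) → Set
Windowed r d f = ∀ i w → f (i % d) (take r w) ≡ f i w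

module _ (M : FiniteMonoid) where
  open FiniteMonoid M

  run : ∀ {k} → (ℕ → Word k → Carrier) → Word k → Carrier
  run f []      = ε
  run f (a ∷ w) = f 0 (a ∷ w) ∙ run (f ∘ suc) w

-- The form in which languages pass from one alphabet to another. Correctness is restricted to `X`,
-- since the constants of a formula have fixed truth values only on a class of words.
record Recogniser {v} (V : Pred FiniteMonoid v) {k} (r d : ℕ) .{{_ : NonZero d}}
                  (X L : Language k) : Set v where
  field
    M        : FiniteMonoid
    M∈V      : M ∈ V
    value    : ℕ → Word k → FiniteMonoid.Carrier M
    windowed : Windowed r d value
    accept   : Subset (FiniteMonoid.size M)
    correct  : ∀ w → w ∈ X → w ∈ L ⇔ run M value w ∈ₛ accept

module _ {k b : ℕ} where

  relabelled : (ℕ → Word k → Fin b) → Word k → Word b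
  relabelled c w = tabulate {n = length w} (λ x → c (toℕ x) (drop (toℕ x) w))

  -- Transported to the positions of `w` itself, so that one assignment of variables serves both
  -- words when formulas are compared.
  relabelling : (ℕ → Word k → Fin b) → (w : Word k) → Labelling (length w)
  relabelling c w = subst Labelling (length-tabulate _) (labels (relabelled c w))

  relabelling-sat : ∀ {S} c w (φ : Sentence S) → relabelled c w ⊨ φ ⇔ Sat (relabelling c w) [] [] φ
  relabelling-sat {S} c w φ = go (length-tabulate _) (labels (relabelled c w))
    where
    go : ∀ {m n} (e : m ≡ n) (ℓ : Labelling m) → Sat ℓ [] [] φ ⇔ Sat (subst Labelling e ℓ) [] [] φ
    go refl ℓ = ⇔.refl

  relabelling-≡ : ∀ c w x → relabelling c w x ≡ toℕ (c (toℕ x) (drop (toℕ x) w))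
  relabelling-≡ c w x = trans (go (length-tabulate _) (labels (relabelled c w)) x)
    (cong toℕ (lookup-tabulate {n = length w} (λ x → c (toℕ x) (drop (toℕ x) w)) x))
    where
    go : ∀ {m n} (e : m ≡ n) (ℓ : Labelling m) x → subst Labelling e ℓ x ≡ ℓ (cast (sym e) x)
    go refl ℓ x = cong ℓ (sym (cast-is-id refl x))

  foldr-relabelled : ∀ M (g : Fin b → FiniteMonoid.Carrier M) c w → let open FiniteMonoid M in
    foldr (λ a → g a ∙_) ε (relabelled c w) ≡ run M (λ i y → g (c i y)) w
  foldr-relabelled M g c []      = refl
  foldr-relabelled M g c (a ∷ w) = cong (FiniteMonoid._∙_ M _) (foldr-relabelled M g (c ∘ suc) w)

module _ (M : FiniteMonoid) where
  open FiniteMonoid M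
  open IsMonoid isMonoid using (identityˡ; assoc; identityʳ)

  -- The elements of the monoid serve as letters, and the morphism multiplies a word out.
  -- Definability of this language is what lets a formula of `F` evaluate products in `M`.
  recognizes-product : ∀ P → Recognizes M (λ w → foldr _∙_ ε w ∈ₛ P)
  recognizes-product P = foldr _∙_ ε , isHom , P , λ w → ⇔.refl
    where
    homo : ∀ x y → foldr _∙_ ε (x ++ y) ≡ foldr _∙_ ε x ∙ foldr _∙_ ε y
    homo []      y = sym (identityˡ _)
    homo (a ∷ x) y = trans (cong (a ∙_) (homo x y)) (sym (assoc a _ _))

    isHom : _
    isHom = record
      { isMagmaHomomorphism = record
        { isRelHomomorphism = record { cong = cong (foldr _∙_ ε) } ; homo = homo }
      ; ε-homo = refl
      }

weight⊕ : ∀ {S₀ S} → (∀ {r} → Symbol S r → ℕ) → ∀ {r} → Symbol (S₀ ⊕ S) r → ℕ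
weight⊕ weight (inj₁ R) = 0
weight⊕ weight (inj₂ R) = weight R

-- Describes symbols that can be absorbed into letters. The window has `suc N` letters so that even
-- for `N = 0` it contains the letter of the position itself. Nullary symbols have no `test`; they
-- are fixed on a class of words instead.
record Source (S : Signature) (N d : ℕ) .{{_ : NonZero d}} : Set where
  field
    weight   : ∀ {r} → Symbol S r → ℕ
    arity    : ∀ {r} → Symbol S r → r ≡ 0 ⊎ r ≡ 1
    test     : ∀ {k} → Symbol S 1 → ℕ → Word k → Bool
    test-sat : ∀ {k} R (w : Word k) (x : Fin (length w)) → weight R ≤ N →
      T (interp S R (labels w) (x ∷ [])) ⇔ T (test R (toℕ x % d) (take (suc N) (drop (toℕ x) w)))

-- Describes enrichments able to recover a window and a residue from the original letters.
-- `position` is a leaf and not a symbol because for `d = 1` a trivially true formula is enough.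
record Target (S : Signature) (d : ℕ) .{{_ : NonZero d}} : Set₁ where
  field
    local     : ∀ {r} → LocalSymbol r → Symbol S r
    local-sat : ∀ {r n} (R : LocalSymbol r) (ℓ : Labelling n) xs →
      interp S (local R) ℓ xs ≡ localInterp R ℓ xs
    position  : ∀ {S₀ p q} → Fin d → (x : Fin p) → Leaf (S₀ ⊕ S) p q ⁅ x ⁆
    position-sat : ∀ {S₀ p q n} i x (ℓ : Labelling n) (ρ : Vec (Fin n) p) (θ : Vec (Subset n) q) →
      Sat ℓ ρ θ (formula (position {S₀} i x)) ⇔ toℕ (Vec.lookup ρ x) % d ≡ toℕ i

module _ {f v : Level} {σ : NumericalSignature} {F : Pred (Sentence (numerical σ)) f}
         {V : Pred FiniteMonoid v} (isFragment : IsFragment F) (equivalent : EquivalentTo F V) where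

  module _ {S : Signature} {N d : ℕ} .{{_ : NonZero d}} (source : Source S N d)
           {k : ℕ} (X : Language k) (constant : Symbol S 0 → Bool) where
    open Source source

    module _ (constant-sat : ∀ R w → weight R ≤ N → w ∈ X →
                T (interp S R {length w} (labels w) []) ⇔ T (constant R)) where

      private
        B : ℕ
        B = d * codes {k} (suc N)

        code : ℕ → Word k → Fin B
        code i w = combine (fromℕ< (m%n<n i d)) (encode (suc N) w)

        index : Fin B → ℕ
        index z = toℕ (proj₁ (remQuot {d} (codes {k} (suc N)) z))

        window : Fin B → Word k
        window z = decode (suc N) (proj₂ (remQuot {d} (codes {k} (suc N)) z))

        index-code : ∀ i w → index (code i w) ≡ i % d
        index-code i w = trans
          (cong (toℕ ∘ proj₁) (remQuot-combine {d} (fromℕ< (m%n<n i d)) (encode (suc N) w)))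
          (toℕ-fromℕ< (m%n<n i d))

        window-code : ∀ i w → window (code i w) ≡ take (suc N) w
        window-code i w = trans
          (cong (decode (suc N) ∘ proj₂) (remQuot-combine {d} (fromℕ< (m%n<n i d)) (encode (suc N) w)))
          (decode-encode (suc N) w)

        code-windowed : Windowed (suc N) d code
        code-windowed i w = cong₂ combine
          (toℕ-injective (trans (toℕ-fromℕ< (m%n<n (i % d) d))
            (trans (m%n%n≡m%n i d) (sym (toℕ-fromℕ< (m%n<n i d))))))
          (encode-take (suc N) w)

        -- The alphabet of codes is finite, so every condition on residue and window is a
        -- disjunction of letter predicates.
        anyLetter : ∀ {p q} → (Fin B → Bool) → (x : Fin p) → Leaf (numerical σ) p q ⁅ x ⁆
        anyLetter h x = ⋁ (fresh x) B (λ z → letterᴸ (toℕ z) x ∧ᴸ const (fresh x) (h z))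

        anyLetter-⊩ : ∀ {p q n} h x (ℓ : Labelling n) (ρ : Vec (Fin n) p) (θ : Vec (Subset n) q) z →
          ℓ (Vec.lookup ρ x) ≡ toℕ z → ⟨ ℓ , ρ , θ ⟩ ⊩ anyLetter h x ⇔ T (h z)
        anyLetter-⊩ h x ℓ ρ θ z e = ⇔.trans (⋁-⊩ ⟨ ℓ , ρ , θ ⟩ (fresh x) B _) (mk⇔
          (λ (y , e′ , t) → subst (T ∘ h) (toℕ-injective (trans (sym e′) e))
                                  (to (const-⊩ ⟨ ℓ , ρ , θ ⟩ (fresh x) (h y)) t))
          (λ t → z , e , from (const-⊩ ⟨ ℓ , ρ , θ ⟩ (fresh x) (h z)) t))

        onLetterB : ∀ {p q} → Letter → (x : Fin p) → Leaf (numerical σ) p q ⁅ x ⁆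
        onLetterB a = anyLetter (λ z → hasLetter a (window z) 0)

        constᴸ : ∀ {S p q} → Bool → Leaf S p q ⋃⁅ [] ⁆
        constᴸ true  = record { formula = ⊤′ ; qf = ⊤′ ; free₁≡ = refl ; free₂≡ = refl }
        constᴸ false = record { formula = ⊥′ ; qf = ⊥′ ; free₁≡ = refl ; free₂≡ = refl }

        onExtra : ∀ {p q r} → r ≡ 0 ⊎ r ≡ 1 → Symbol S r → (xs : Vec (Fin p) r) →
                  Leaf (numerical σ) p q ⋃⁅ xs ⁆
        -- A nullary symbol has no variable whose letter could be consulted; its truth value on `X`
        -- is supplied by `constant`.
        onExtra (inj₁ refl) R []       = constᴸ (constant R)
        onExtra (inj₂ refl) R (x ∷ []) =
          weaken (sym (∪-identityʳ _)) (anyLetter (λ z → test R (index z) (window z)) x)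

        onAtomB : ∀ {p q r} → Symbol (numerical σ ⊕ S) r → (xs : Vec (Fin p) r) →
                  Leaf (numerical σ) p q ⋃⁅ xs ⁆
        onAtomB (inj₁ R) xs = atomᴸ R xs
        onAtomB (inj₂ R) xs = onExtra (arity R) R xs

        τ : Translation (numerical σ ⊕ S) (numerical σ)
        τ = record { onLetter = onLetterB ; onAtom = onAtomB }

        module _ (w : Word k) (w∈X : w ∈ X) where

          ℓ : Labelling (length w)
          ℓ = relabelling code w

          at-code : ∀ {p q} h x (ρ : Vec (Fin (length w)) p) (θ : Vec (Subset (length w)) q) →
            ⟨ ℓ , ρ , θ ⟩ ⊩ anyLetter h x ⇔
            T (h (code (toℕ (Vec.lookup ρ x)) (drop (toℕ (Vec.lookup ρ x)) w)))
          at-code h x ρ θ = anyLetter-⊩ h x ℓ ρ θ _ (relabelling-≡ code w (Vec.lookup ρ x))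

          letter-sat : ∀ {p q} a x (ρ : Vec (Fin (length w)) p) (θ : Vec (Subset (length w)) q) →
            labels w (Vec.lookup ρ x) ≡ a ⇔ Sat ℓ ρ θ (formula (onLetterB a x))
          letter-sat a x ρ θ = ⇔.sym (⇔.trans (at-code (λ z → hasLetter a (window z) 0) x ρ θ)
            (⇔.trans (≡⇒⇔ (cong (λ y → T (hasLetter a y 0)) (window-code (toℕ y) (drop (toℕ y) w))))
            (⇔.trans (≡⇒⇔ (cong T (hasLetter-take a (suc N) (drop (toℕ y) w) 0 (s≤s z≤n))))
            (⇔.trans (≡⇒⇔ (cong T (hasLetter-drop a (toℕ y) w 0)))
            (⇔.trans (hasLetter-lookup a w _)
            (mk⇔ (λ (z , e , e′) → subst (λ z → labels w z ≡ a) (toℕ-injective (trans e (+-identityʳ _))) e′)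
                 (λ e → y , sym (+-identityʳ _) , e)))))))
            where
            y = Vec.lookup ρ x

          extra-sat : ∀ {p q r} (e : r ≡ 0 ⊎ r ≡ 1) R xs
            (ρ : Vec (Fin (length w)) p) (θ : Vec (Subset (length w)) q) → weight R ≤ N →
            T (interp S R (labels w) (Vec.map (Vec.lookup ρ) xs)) ⇔ Sat ℓ ρ θ (formula (onExtra e R xs))
          extra-sat (inj₁ refl) R [] ρ θ R≤N = ⇔.trans (constant-sat R w R≤N w∈X) (sat-const (constant R))
            where
            sat-const : ∀ b → T b ⇔ Sat ℓ ρ θ (formula (constᴸ {numerical σ} b))
            sat-const true  = ⇔.refl
            sat-const false = ⇔.refl
          extra-sat (inj₂ refl) R (x ∷ []) ρ θ R≤N = ⇔.trans (test-sat R w y R≤N)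
            (⇔.trans (≡⇒⇔ (sym (cong₂ (λ i z → T (test R i z)) (index-code (toℕ y) (drop (toℕ y) w))
                                                               (window-code (toℕ y) (drop (toℕ y) w)))))
                     (⇔.sym (at-code (λ z → test R (index z) (window z)) x ρ θ)))
            where y = Vec.lookup ρ x

          atom-sat : ∀ {p q r} (R : Symbol (numerical σ ⊕ S) r) xs
            (ρ : Vec (Fin (length w)) p) (θ : Vec (Subset (length w)) q) →
            weight⊕ {numerical σ} {S} weight R ≤ N →
            T (interp (numerical σ ⊕ S) R (labels w) (Vec.map (Vec.lookup ρ) xs)) ⇔
            Sat ℓ ρ θ (formula (onAtomB R xs))
          atom-sat (inj₁ R) xs ρ θ _   = ⇔.refl
          atom-sat (inj₂ R) xs ρ θ R≤N = extra-sat (arity R) R xs ρ θ R≤N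

          sat : ∀ (φ : Sentence (numerical σ ⊕ S)) → bound (weight⊕ {numerical σ} {S} weight) φ ≤ N →
                w ⊨ φ ⇔ relabelled code w ⊨ translate τ φ
          sat φ φ≤N = ⇔.trans
            (translate-sat τ (weight⊕ {numerical σ} {S} weight) N (labels w) ℓ letter-sat atom-sat φ [] [] φ≤N)
            (⇔.sym (relabelling-sat code w (translate τ φ)))

      -- Over the alphabet of codes only symbols of `σ` remain, so the translated language is
      -- recognised in `V`. The value of a position is the image of its code under the recognising
      -- morphism, and a morphism is the product of its values on letters.
      formula⇒recogniser : ∀ (φ : Sentence (numerical σ ⊕ S)) → φ ∈ Enrich F S →
                           bound (weight⊕ {numerical σ} {S} weight) φ ≤ N →
                           Recogniser V (suc N) d X (_⊨ φ)
      formula⇒recogniser φ φ∈ φ≤N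
        with to (equivalent (_⊨ translate τ φ)) (translate τ φ , Enrich⇒F isFragment τ φ∈ , λ w → ⇔.refl)
      ... | M , M∈V , h , isHom , P , h-correct = record
        { M        = M
        ; M∈V      = M∈V
        ; value    = λ i w → h (code i w ∷ [])
        ; windowed = λ i w → cong (λ z → h (z ∷ [])) (code-windowed i w)
        ; accept   = P
        ; correct  = λ w w∈X → ⇔.trans (sat w w∈X φ φ≤N) (⇔.trans (h-correct (relabelled code w))
            (≡⇒⇔ (cong (_∈ₛ P)
              (trans (h-foldr (relabelled code w)) (foldr-relabelled M (λ z → h (z ∷ [])) code w)))))
        }
        where
        open FiniteMonoid M using (_∙_; ε)
        open MonoidMorphisms.IsMonoidHomomorphism isHom

        h-foldr : ∀ y → h y ≡ foldr (λ z → h (z ∷ []) ∙_) ε y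
        h-foldr []      = ε-homo
        h-foldr (z ∷ y) = trans (homo (z ∷ []) y) (cong (h (z ∷ []) ∙_) (h-foldr y))

  module _ {S : Signature} {d : ℕ} .{{_ : NonZero d}} (target : Target S d) {k r : ℕ} where
    open Target target

    -- A sentence of `F` over the alphabet `M` describes the accepted products. In it, the letter
    -- predicate for `m` is replaced by a quantifier-free test whether the position has value `m`,
    -- which reads a residue and a window.
    recogniser⇒formula : ∀ {X L : Language k} → Recogniser V r d X L →
      ∃[ φ ] φ ∈ Enrich F S × (∀ w → w ∈ X → w ∈ L ⇔ w ⊨ φ)
    recogniser⇒formula {X} {L} 𝓡 = translate τ ψ , F⇒Enrich τ ψ∈F , λ w w∈X →
      ⇔.trans (correct w w∈X) (⇔.trans
        (≡⇒⇔ (cong (_∈ₛ accept) (sym (foldr-relabelled M id value w))))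
        (⇔.trans (ψ-correct (relabelled value w)) (sat w)))
      where
      open Recogniser 𝓡
      open FiniteMonoid M using (_∙_; ε)

      defined : Definable F (λ w → foldr _∙_ ε w ∈ₛ accept)
      defined = from (equivalent _) (M , M∈V , recognizes-product M accept)

      ψ = proj₁ defined
      ψ∈F = proj₁ (proj₂ defined)
      ψ-correct = proj₂ (proj₂ defined)

      at+ : ∀ {p q} (x : Fin p) → Letter → ℕ → Leaf (numerical σ ⊕ S) p q ⁅ x ⁆
      at+ x a j = weaken (∪-identityʳ _) (atomᴸ (inj₂ (local (letterAt+ a j))) (x ∷ []))

      hasValue : Letter → ℕ → Word k → Bool
      hasValue m i y = does (toℕ (value i y) ≟ m)

      onLetterV : ∀ {p q} → Letter → (x : Fin p) → Leaf (numerical σ ⊕ S) p q ⁅ x ⁆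
      onLetterV m x = ⋁ (fresh x) d (λ i → position i x ∧ᴸ tree r (at+ x) (hasValue m (toℕ i)))

      τ : Translation (numerical σ) (numerical σ ⊕ S)
      τ = record { onLetter = onLetterV ; onAtom = λ R → atomᴸ (inj₁ R) }

      module _ (w : Word k) where

        letter-sat : ∀ {p q} m x (ρ : Vec (Fin (length w)) p) (θ : Vec (Subset (length w)) q) →
          relabelling value w (Vec.lookup ρ x) ≡ m ⇔ Sat (labels w) ρ θ (formula (onLetterV m x))
        letter-sat m x ρ θ = ⇔.sym (⇔.trans (⋁-⊩ 𝓿 (fresh x) d _) (mk⇔
          (λ (i , e , t) → trans (relabelling-≡ value w y) (to (T-does (_ ≟ m))
            (subst (λ z → T (does (toℕ z ≟ m))) (at-window i (to (position-sat i x _ ρ θ) e))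
                   (to (tree-sat i) t))))
          (λ e → let i = fromℕ< (m%n<n (toℕ y) d) ; e′ = sym (toℕ-fromℕ< (m%n<n (toℕ y) d)) in
            i , from (position-sat i x _ ρ θ) e′ , from (tree-sat i)
              (subst (λ z → T (does (toℕ z ≟ m))) (sym (at-window i e′))
                (from (T-does (_ ≟ m)) (trans (sym (relabelling-≡ value w y)) e))))))
          where
          𝓿 = ⟨ labels w , ρ , θ ⟩
          y = Vec.lookup ρ x

          at-window : ∀ i → toℕ y % d ≡ toℕ i →
                      value (toℕ i) (take r (drop (toℕ y) w)) ≡ value (toℕ y) (drop (toℕ y) w)
          at-window i e = trans (cong (λ j → value j (take r (drop (toℕ y) w))) (sym e))
                                (windowed (toℕ y) (drop (toℕ y) w))

          tree-sat : ∀ i → 𝓿 ⊩ tree r (at+ x) (hasValue m (toℕ i)) ⇔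
                           T (hasValue m (toℕ i) (take r (drop (toℕ y) w)))
          tree-sat i = tree-⊩ 𝓿 r (at+ x) _ (drop (toℕ y) w) λ a j →
            ⇔.trans (≡⇒⇔ (cong T (local-sat (letterAt+ a j) (labels w) (y ∷ [])))) (at+-sat a j w y)

        sat : relabelled value w ⊨ ψ ⇔ w ⊨ translate τ ψ
        sat = ⇔.trans (relabelling-sat value w ψ)
          (translate-sat τ (λ _ → 0) _ (relabelling value w) (labels w) letter-sat
            (λ R xs ρ θ _ → ⇔.refl) ψ [] [] ≤-refl)

-- Case distinctions on prefixes and suffixes

localArity : ∀ {r} → LocalSymbol r → r ≡ 0 ⊎ r ≡ 1
localArity (letterAt+ _ _)  = inj₂ refl
localArity (letterMin+ _ _) = inj₁ refl
localArity (letterMax- _ _) = inj₁ refl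

-- `suc j`, as a window must have more than `j` letters to show the one at distance `j`.
localWeight : ∀ {r} → LocalSymbol r → ℕ
localWeight (letterAt+ _ j)  = suc j
localWeight (letterMin+ _ j) = suc j
localWeight (letterMax- _ j) = suc j

localTest : ∀ {k} → LocalSymbol 1 → Word k → Bool
localTest (letterAt+ a j) w = hasLetter a w j

localTest-sat : ∀ {k N} R (w : Word k) (x : Fin (length w)) → localWeight R ≤ N →
  T (localInterp R (labels w) (x ∷ [])) ⇔ T (localTest R (take (suc N) (drop (toℕ x) w)))
localTest-sat {N = N} (letterAt+ a j) w x j<N = ⇔.trans (at+-sat a j w x)
  (≡⇒⇔ (cong T (sym (hasLetter-take a (suc N) (drop (toℕ x) w) j (m≤n⇒m≤1+n j<N)))))

localSource : ∀ N → Source Local N 1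
localSource N = record
  { weight = localWeight ; arity = localArity ; test = λ R _ → localTest R ; test-sat = localTest-sat }

modWeight : ∀ {r} → Symbol (Local ⊕ MOD) r → ℕ
modWeight (inj₁ R)       = localWeight R
modWeight (inj₂ (d , _)) = d

modTest : ∀ {d} → ModSymbol d 1 → ℕ → Bool
modTest {d} (position≡ i) n = does (_%_ n d {{nonZeroIndex i}} ≟ toℕ i)

-- A residue modulo `d` determines the residue modulo each divisor of `d`. The weight of a modular
-- symbol is its modulus, so only moduli up to `N` have to divide `d`.
modSource : ∀ N d .{{_ : NonZero d}} → (∀ {d′} → NonZero d′ → d′ ≤ N → d′ ∣ d) →
            Source (Local ⊕ MOD) N d
modSource N d divides = record
  { weight   = modWeight
  ; arity    = λ { (inj₁ R)                 → localArity R
                 ; (inj₂ (_ , position≡ _)) → inj₂ refl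
                 ; (inj₂ (_ , length≡ _))   → inj₁ refl }
  ; test     = λ { (inj₁ R) _ w → localTest R w ; (inj₂ (_ , R)) n _ → modTest R n }
  ; test-sat = λ { (inj₁ R) w x R≤N → localTest-sat R w x R≤N
                 ; (inj₂ (d′ , position≡ i)) w x d′≤N → ≡⇒⇔ (cong (λ n → T (does (n ≟ toℕ i)))
                     (sym (m∣n⇒o%n%m≡o%m d′ d (toℕ x) {{nonZeroIndex i}} (divides (nonZeroIndex i) d′≤N)))) }
  }

localTarget : Target Local 1
localTarget = record
  { local        = id
  ; local-sat    = λ _ _ _ → refl
  ; position     = λ _ x → const (fresh x) true
  ; position-sat = λ { {S₀} zero x ℓ ρ θ → mk⇔
      (λ _ → n%1≡0 (toℕ (Vec.lookup ρ x)))
      (λ _ → from (const-⊩ ⟨ ℓ , ρ , θ ⟩ (fresh {S₀ ⊕ Local} x) true) _) }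
  }

modTarget : ∀ d .{{_ : NonZero d}} → Target (Local ⊕ MOD^ d) d
modTarget d = record
  { local        = inj₁
  ; local-sat    = λ _ _ _ → refl
  ; position     = λ i x → weaken (∪-identityʳ _) (atomᴸ (inj₂ (inj₂ (position≡ i))) (x ∷ []))
  ; position-sat = λ i x ℓ ρ θ → T-does (_ ≟ toℕ i)
  }

module _ {f : Level} {S : Signature} (G : Pred (Sentence S) f) where

  DefinableOn : ∀ {k} → Language k → Language k → Set f
  DefinableOn X L = ∃[ φ ] φ ∈ G × (∀ w → w ∈ X → w ∈ L ⇔ w ⊨ φ)

module _ {f : Level} {S : Signature} {G : Pred (Sentence S) f} (isFragment : IsFragment G) where
  open IsFragment isFragment

  -- The glued sentence is the disjunction of the `α i ∧′ φ i`. The `α i` may overlap: wherever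
  -- `α i` holds, `φ i` already agrees with `L`.
  cover : ∀ {k} {X L : Language k} m (α : Fin m → Sentence S) (Y : Fin m → Language k) →
    (∀ i → QuantifierFree (α i)) →
    (∀ w → w ∈ X → ∃[ i ] w ⊨ α i) → (∀ i w → w ∈ X → w ⊨ α i → w ∈ Y i) →
    (∀ i → DefinableOn G (Y i) L) → DefinableOn G X L
  cover {k} {X} {L} m α Y α-qf total classes defined = ψ m α φ , ψ∈G m α φ α-qf φ∈G , λ w w∈X →
    ⇔.trans (mk⇔
      (λ w∈L → let (i , t) = total w w∈X in i , t , to (φ-correct i w (classes i w w∈X t)) w∈L)
      (λ (i , t , u) → from (φ-correct i w (classes i w w∈X t)) u))
    (⇔.sym (ψ-sat m α φ w))
    where
    φ : Fin m → Sentence S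
    φ i = proj₁ (defined i)

    φ∈G : ∀ i → φ i ∈ G
    φ∈G i = proj₁ (proj₂ (defined i))

    φ-correct : ∀ i w → w ∈ Y i → w ∈ L ⇔ w ⊨ φ i
    φ-correct i = proj₂ (proj₂ (defined i))

    ψ : ∀ m (α φ : Fin m → Sentence S) → Sentence S
    ψ zero    α φ = ⊥′
    ψ (suc m) α φ = (α zero ∧′ φ zero) ∨′ ψ m (α ∘ suc) (φ ∘ suc)

    ψ∈G : ∀ m α φ → (∀ i → QuantifierFree (α i)) → (∀ i → φ i ∈ G) → ψ m α φ ∈ G
    ψ∈G zero    α φ q e = quantifier-free ⊥′
    ψ∈G (suc m) α φ q e = ∨-closed (∧-closed (quantifier-free (q zero)) (e zero))
                                   (ψ∈G m (α ∘ suc) (φ ∘ suc) (q ∘ suc) (e ∘ suc))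

    ψ-sat : ∀ m α φ (w : Word k) → w ⊨ ψ m α φ ⇔ (∃[ i ] w ⊨ α i × w ⊨ φ i)
    ψ-sat zero    α φ w = mk⇔ (λ ()) (λ ())
    ψ-sat (suc m) α φ w = mk⇔
      (λ { (inj₁ t) → zero , t
         ; (inj₂ u) → let (i , t) = to (ψ-sat m (α ∘ suc) (φ ∘ suc) w) u in suc i , t })
      (λ { (zero , t) → inj₁ t ; (suc i , t) → inj₂ (from (ψ-sat m (α ∘ suc) (φ ∘ suc) w) (i , t)) })

  -- y w is read through the sentences at a j, which express that the letter
  -- of y w at index j is a.

  cover-reading : ∀ {k s} {X L : Language k} (y : Word k → Word k) (at : Letter → ℕ → Leaf S 0 0 s) →
    (∀ w a j → ⟨ labels w , [] , [] ⟩ ⊩ at a j ⇔ T (hasLetter a (y w) j)) → ∀ r →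
    (∀ z → DefinableOn G (λ w → w ∈ X × take r (y w) ≡ z) L) → DefinableOn G X L
  cover-reading {k} {s} {X} y at at-⊩ r defined =
    cover (codes {k} r) (formula ∘ α) (λ i w → w ∈ X × take r (y w) ≡ decode r i) (qf ∘ α)
      (λ w _ → encode r (y w) , from (α-sat w _) refl)
      (λ i w w∈X t → w∈X , trans (sym (decode-encode r (y w))) (cong (decode r) (to (α-sat w i) t)))
      (defined ∘ decode r)
    where
    h : Fin (codes {k} r) → Word k → Bool
    h i z = does (encode r z Fin.≟ i)

    α : Fin (codes {k} r) → Leaf S 0 0 s
    α i = tree r at (h i)

    α-sat : ∀ w i → w ⊨ formula (α i) ⇔ encode r (y w) ≡ i
    α-sat w i = ⇔.trans (tree-⊩ ⟨ labels w , [] , [] ⟩ r at (h i) (y w) (at-⊩ w))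
      (⇔.trans (T-does (encode r (take r (y w)) Fin.≟ i)) (≡⇒⇔ (cong (_≡ i) (encode-take r (y w)))))

module _ {f : Level} {S₀ S : Signature} {d : ℕ} .{{_ : NonZero d}} (target : Target S d)
         {G : Pred (Sentence (S₀ ⊕ S)) f} (isFragment : IsFragment G) {k : ℕ} {X L : Language k} where
  open Target target

  cover-prefix : ∀ r → (∀ z → DefinableOn G (λ w → w ∈ X × take r w ≡ z) L) → DefinableOn G X L
  cover-prefix = cover-reading isFragment id (λ a j → atomᴸ (inj₂ (local (letterMin+ a j))) [])
    (λ w a j → ⇔.trans (≡⇒⇔ (cong T (local-sat (letterMin+ a j) (labels w) []))) (min+-sat a j w))

  cover-suffix : ∀ r → (∀ z → DefinableOn G (λ w → w ∈ X × take r (reverse w) ≡ z) L) → DefinableOn G X L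
  cover-suffix = cover-reading isFragment reverse (λ a j → atomᴸ (inj₂ (local (letterMax- a j))) [])
    (λ w a j → ⇔.trans (≡⇒⇔ (cong T (local-sat (letterMax- a j) (labels w) []))) (max--sat a j w))

-- Prefixes of concatenations and products over them

module _ {A : Set} where

  take-++-cong : ∀ (x : List A) {m n} {y y′} → m ≤ length x + n → take n y ≡ take n y′ →
                 take m (x ++ y) ≡ take m (x ++ y′)
  take-++-cong []      {m} {n} {y} {y′} m≤n e = begin
    take m y            ≡⟨ cong (λ i → take i y) (m≤n⇒m⊓n≡m m≤n) ⟨
    take _ y            ≡⟨ take-take m n y ⟨
    take m (take n y)   ≡⟨ cong (take m) e ⟩
    take m (take n y′)  ≡⟨ take-take m n y′ ⟩
    take _ y′           ≡⟨ cong (λ i → take i y′) (m≤n⇒m⊓n≡m m≤n) ⟩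
    take m y′           ∎
    where open ≡-Reasoning
  take-++-cong (a ∷ x) {zero}  _         e = refl
  take-++-cong (a ∷ x) {suc m} (s≤s m≤n) e = cong (a ∷_) (take-++-cong x m≤n e)

  take-length-++ : ∀ (x : List A) y → take (length x) (x ++ y) ≡ x
  take-length-++ []      y = refl
  take-length-++ (a ∷ x) y = cong (a ∷_) (take-length-++ x y)

  drop-length-++ : ∀ (x : List A) y → drop (length x) (x ++ y) ≡ y
  drop-length-++ []      y = refl
  drop-length-++ (a ∷ x) y = drop-length-++ x y

module _ {A B : Set} (g : A → List B) where

  -- Blocks are nonempty, so whatever lies beyond the first `n` blocks starts after the first `n`
  -- letters.
  take-concatMap : (∀ c → 1 ≤ length (g c)) → ∀ n u v →
                   take n (concatMap g (take n u) ++ v) ≡ take n (concatMap g u ++ v)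
  take-concatMap 1≤g zero    u       v = refl
  take-concatMap 1≤g (suc n) []      v = refl
  take-concatMap 1≤g (suc n) (c ∷ u) v
    rewrite ++-assoc (g c) (concatMap g (take n u)) v | ++-assoc (g c) (concatMap g u) v =
    take-++-cong (g c) (+-monoˡ-≤ n (1≤g c)) (take-concatMap 1≤g n u v)

  take-concatMap-≡ : (∀ c → 1 ≤ length (g c)) → ∀ n {u p} v → take n u ≡ p →
                     take n (concatMap g u ++ v) ≡ take n (concatMap g p ++ v)
  take-concatMap-≡ 1≤g n {u} v refl = sym (take-concatMap 1≤g n u v)

  reverse-concatMap : ∀ u → reverse (concatMap g u) ≡ concatMap (reverse ∘ g) (reverse u)
  reverse-concatMap []      = refl
  reverse-concatMap (c ∷ u) = begin
    reverse (g c ++ concatMap g u)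
      ≡⟨ reverse-++ (g c) _ ⟩
    reverse (concatMap g u) ++ reverse (g c)
      ≡⟨ cong (_++ reverse (g c)) (reverse-concatMap u) ⟩
    concatMap (reverse ∘ g) (reverse u) ++ reverse (g c)
      ≡⟨ cong (concatMap (reverse ∘ g) (reverse u) ++_) (++-identityʳ (reverse (g c))) ⟨
    concatMap (reverse ∘ g) (reverse u) ++ concatMap (reverse ∘ g) (c ∷ [])
      ≡⟨ concatMap-++ (reverse ∘ g) (reverse u) (c ∷ []) ⟨
    concatMap (reverse ∘ g) (reverse u ++ c ∷ [])
      ≡⟨ cong (concatMap (reverse ∘ g)) (unfold-reverse c u) ⟨
    concatMap (reverse ∘ g) (reverse (c ∷ u))
      ∎
    where open ≡-Reasoning

module _ (M : FiniteMonoid) {k : ℕ} where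
  open FiniteMonoid M
  open IsMonoid isMonoid using (identityˡ; identityʳ; assoc)

  -- The context `y` is an argument because the windows of the last positions of `x` extend into it.
  runBefore : (ℕ → Word k → Carrier) → Word k → Word k → Carrier
  runBefore f []      y = ε
  runBefore f (a ∷ x) y = f 0 (a ∷ x ++ y) ∙ runBefore (f ∘ suc) x y

  run-++ : ∀ f x y → run M f (x ++ y) ≡ runBefore f x y ∙ run M (f ∘ (length x +_)) y
  run-++ f []      y = sym (identityˡ _)
  run-++ f (a ∷ x) y = trans (cong (f 0 (a ∷ x ++ y) ∙_) (run-++ (f ∘ suc) x y)) (sym (assoc _ _ _))

  run-cong : ∀ {f g : ℕ → Word k → Carrier} → (∀ i w → f i w ≡ g i w) → ∀ w → run M f w ≡ run M g w
  run-cong e []      = refl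
  run-cong e (a ∷ w) = cong₂ _∙_ (e 0 (a ∷ w)) (run-cong (e ∘ suc) w)

  runBefore-cong : ∀ {f r x y y′} → (∀ i {w w′} → take r w ≡ take r w′ → f i w ≡ f i w′) →
                   take r y ≡ take r y′ → runBefore f x y ≡ runBefore f x y′
  runBefore-cong {x = []}    f-local e = refl
  runBefore-cong {r = r} {x = a ∷ x} f-local e = cong₂ _∙_
    (f-local 0 (take-++-cong (a ∷ x) (m≤n+m r (length (a ∷ x))) e)) (runBefore-cong {x = x} (f-local ∘ suc) e)

  runBefore-ε : ∀ {f} x y → (∀ i w → i < length x → f i w ≡ ε) → runBefore f x y ≡ ε
  runBefore-ε []      y f≡ε = refl
  runBefore-ε (a ∷ x) y f≡ε = trans
    (cong₂ _∙_ (f≡ε 0 _ (s≤s z≤n)) (runBefore-ε x y (λ i w i<x → f≡ε (suc i) w (s≤s i<x)))) (identityˡ ε)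

  run-short : ∀ {f s} (v : Word k) → (∀ i w → length w < s → f i w ≡ ε) → length v < s → run M f v ≡ ε
  run-short []      f≡ε v<s = refl
  run-short (a ∷ v) f≡ε v<s = trans
    (cong₂ _∙_ (f≡ε 0 _ v<s) (run-short v (f≡ε ∘ suc) (<-trans (n<1+n _) v<s))) (identityˡ ε)

module _ {k d : ℕ} .{{_ : NonZero d}} {A : Set} {r : ℕ} {f : ℕ → Word k → A} (windowed : Windowed r d f) where

  windowed-take : ∀ i {w w′} → take r w ≡ take r w′ → f i w ≡ f i w′
  windowed-take i {w} {w′} e = trans (sym (windowed i w)) (trans (cong (f (i % d)) e) (windowed i w′))

  windowed-mod : ∀ {i j} → i % d ≡ j % d → ∀ w → f i w ≡ f j w
  windowed-mod {i} {j} e w = trans (sym (windowed i w)) (trans (cong (λ i → f i (take r w)) e) (windowed j w))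

  windowed-+ : ∀ i w → f (d + i) w ≡ f i w
  windowed-+ i = windowed-mod (trans (cong (_% d) (+-comm d i)) ([m+n]%n≡m%n i d))

-- Blocks

subset : ∀ {n} → (Fin n → Bool) → Subset n
subset = Vec.tabulate

∈-subset : ∀ {n} h (i : Fin n) → i ∈ₛ subset h ⇔ T (h i)
∈-subset h i = ⇔.trans (mk⇔ []=⇒lookup (lookup⇒[]= i (subset h)))
  (⇔.trans (≡⇒⇔ (cong (_≡ true) (lookup∘tabulate h i))) (T≡true (h i)))
  where
  T≡true : ∀ b → b ≡ true ⇔ T b
  T≡true true  = mk⇔ _ (λ _ → refl)
  T≡true false = mk⇔ (λ ()) (λ ())

module _ {K k D : ℕ} {g : Fin K → Word k} (length-g : ∀ c → length (g c) ≡ D) where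

  length-concatMap : ∀ u v → length (concatMap g u ++ v) ≡ length u * D + length v
  length-concatMap []      v = refl
  length-concatMap (c ∷ u) v = trans (cong length (++-assoc (g c) (concatMap g u) v))
    (trans (length-++ (g c)) (trans (cong₂ _+_ (length-g c) (length-concatMap u v)) (sym (+-assoc D _ _))))

  length-concatMap-% : .{{_ : NonZero D}} → ∀ u v d .{{_ : NonZero d}} → d ∣ D →
                       length (concatMap g u ++ v) % d ≡ length v % d
  length-concatMap-% u v d d∣D = trans (cong (_% d) (length-concatMap u v))
    (%-remove-+ˡ (length v) (∣-trans d∣D (n∣m*n (length u))))

  -- The value of a block is the product of the values of its positions.

  recogniser-concatMap : ∀ {v} {V : Pred FiniteMonoid v} {r} .{{_ : NonZero D}} {X L : Language k} →
    Recogniser V r D X L → (y : Word k) →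
    Recogniser V (suc r) 1 (λ u → concatMap g u ++ y ∈ X) (λ u → concatMap g u ++ y ∈ L)
  recogniser-concatMap {r = r} 𝓡 y = record
    { M        = M
    ; M∈V      = M∈V
    ; value    = blockValue
    ; windowed = blockValue-windowed
    -- The fixed tail `y` contributes a constant factor, which is absorbed into the accepting set.
    ; accept   = subset (λ m → does ((m ∙ run M value y) ∈? accept))
    ; correct  = λ u u∈X → ⇔.trans (correct _ u∈X) (⇔.sym
        (⇔.trans (∈-subset _ (run M blockValue u)) (⇔.trans (T-does (_ ∈? accept))
        (≡⇒⇔ (cong (_∈ₛ accept) (sym (run-blocks u)))))))
    }
    where
    open Recogniser 𝓡
    open FiniteMonoid M
    open IsMonoid isMonoid using (identityˡ; assoc)

    1≤g : ∀ c → 1 ≤ length (g c)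
    1≤g c = subst (1 ≤_) (sym (length-g c)) (>-nonZero⁻¹ D)

    blockValue₀ : Word K → Carrier
    blockValue₀ []      = ε
    blockValue₀ (c ∷ u) = runBefore M value (g c) (concatMap g u ++ y)

    blockValue : ℕ → Word K → Carrier
    blockValue _ = blockValue₀

    -- Blocks start at multiples of `D`, so the residue disappears and the modulus becomes 1. The
    -- window is the block itself and `r` further blocks, enough for `r` letters after it.
    blockValue-windowed : Windowed (suc r) 1 blockValue
    blockValue-windowed i []      = refl
    blockValue-windowed i (c ∷ u) =
      runBefore-cong M {x = g c} (λ i → windowed-take windowed i) (take-concatMap g 1≤g r u y)

    run-blocks : ∀ u → run M value (concatMap g u ++ y) ≡ run M blockValue u ∙ run M value y
    run-blocks []      = sym (identityˡ _)
    run-blocks (c ∷ u) = begin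
      run M value ((g c ++ concatMap g u) ++ y)
        ≡⟨ cong (run M value) (++-assoc (g c) (concatMap g u) y) ⟩
      run M value (g c ++ rest)
        ≡⟨ run-++ M value (g c) rest ⟩
      runBefore M value (g c) rest ∙ run M (value ∘ (length (g c) +_)) rest
        ≡⟨ cong (runBefore M value (g c) rest ∙_) (run-cong M (λ i w →
             trans (cong (λ l → value (l + i) w) (length-g c)) (windowed-+ windowed i w)) rest) ⟩
      runBefore M value (g c) rest ∙ run M value rest
        ≡⟨ cong (runBefore M value (g c) rest ∙_) (run-blocks u) ⟩
      runBefore M value (g c) rest ∙ (run M blockValue u ∙ run M value y)
        ≡⟨ assoc _ _ _ ⟨
      (runBefore M value (g c) rest ∙ run M blockValue u) ∙ run M value y
        ∎
      where
      open ≡-Reasoning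
      rest = concatMap g u ++ y

module Chunks {K k s : ℕ} .{{_ : NonZero s}} {g : Fin K → Word k} (length-g : ∀ c → length (g c) ≡ s)
              (injective : ∀ {c c′} → g c ≡ g c′ → c ≡ c′) where

  block? : (w : Word k) → Dec (∃[ c ] w ≡ g c)
  block? w = any? (λ c → ≡-dec Fin._≟_ w (g c))

  addBlock : ∀ {w} → Dec (∃[ c ] w ≡ g c) → Word K → Word K
  addBlock (yes (c , _)) u = c ∷ u
  -- Decoding stops at the first piece that is not a block, in particular at a tail shorter than
  -- `s`.
  addBlock (no _)        u = []

  chunks : ℕ → Word k → Word K
  chunks zero    w = []
  chunks (suc n) w = addBlock (block? (take s w)) (chunks n (drop s w))

  chunks-take : ∀ n w → chunks n (take (n * s) w) ≡ chunks n w
  chunks-take zero    w = refl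
  chunks-take (suc n) w = cong₂ (λ x y → addBlock (block? x) y)
    (trans (take-take s (s + n * s) w) (cong (λ i → take i w) (m≤n⇒m⊓n≡m (m≤m+n s (n * s)))))
    (trans (cong (chunks n) (sym (take-drop (n * s) s w))) (chunks-take n (drop s w)))

  chunks-short : ∀ n v → length v < s → chunks n v ≡ []
  chunks-short zero    v v<s = refl
  chunks-short (suc n) v v<s with block? (take s v)
  ... | no  _       = refl
  ... | yes (c , e) = contradiction (trans (sym (length-take s v)) (trans (cong length e) (length-g c)))
                        (<⇒≢ (≤-<-trans (m⊓n≤n s (length v)) v<s))

  addBlock-g : ∀ c u → addBlock (block? (g c)) u ≡ c ∷ u
  addBlock-g c u with block? (g c)
  ... | no ¬e        = contradiction (c , refl) ¬e
  ... | yes (c′ , e) = cong (_∷ u) (sym (injective e))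

  chunks-concatMap : ∀ n u v → length v < s → chunks n (concatMap g u ++ v) ≡ take n u
  chunks-concatMap zero    u       v v<s = refl
  chunks-concatMap (suc n) []      v v<s = chunks-short (suc n) v v<s
  chunks-concatMap (suc n) (c ∷ u) v v<s = begin
    chunks (suc n) ((g c ++ concatMap g u) ++ v)
      ≡⟨ cong (chunks (suc n)) (++-assoc (g c) (concatMap g u) v) ⟩
    addBlock (block? (take s (g c ++ rest))) (chunks n (drop s (g c ++ rest)))
      ≡⟨ cong₂ (λ x y → addBlock (block? x) (chunks n y))
           (subst (λ l → take l (g c ++ rest) ≡ g c) (length-g c) (take-length-++ (g c) rest))
           (subst (λ l → drop l (g c ++ rest) ≡ rest) (length-g c) (drop-length-++ (g c) rest)) ⟩
    addBlock (block? (g c)) (chunks n rest)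
      ≡⟨ addBlock-g c (chunks n rest) ⟩
    c ∷ chunks n rest
      ≡⟨ cong (c ∷_) (chunks-concatMap n u v v<s) ⟩
    c ∷ take n u
      ∎
    where
    open ≡-Reasoning
    rest = concatMap g u ++ v

  module _ {v} {V : Pred FiniteMonoid v} {r} {Y L′ : Language K} (𝓡 : Recogniser V r 1 Y L′) where
    open Recogniser 𝓡
    open FiniteMonoid M
    open IsMonoid isMonoid using (identityˡ; identityʳ)

    private
      -- The first position of a block receives the value of the block.

      atStart : ℕ → Word K → Carrier
      atStart zero    (c ∷ u) = value 0 (c ∷ u)
      atStart zero    []      = ε
      atStart (suc _) _       = ε

      letterValue : ℕ → Word k → Carrier
      -- `suc r` blocks are decoded although values need only `r`: for `r = 0` the list would
      -- otherwise be empty, which is the mark of the tail and gives `ε`.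
      letterValue i w = atStart (i % s) (chunks (suc r) w)

      letterValue-windowed : Windowed (suc r * s) s letterValue
      letterValue-windowed i w = cong₂ atStart (m%n%n≡m%n i s) (chunks-take (suc r) w)

      letterValue-short : ∀ i w → length w < s → letterValue i w ≡ ε
      letterValue-short i w w<s =
        trans (cong (atStart (i % s)) (chunks-short (suc r) w w<s)) (atStart-[] (i % s))
        where
        atStart-[] : ∀ n → atStart n [] ≡ ε
        atStart-[] zero    = refl
        atStart-[] (suc n) = refl

      letterValue-start : ∀ c u y → length y < s → letterValue 0 (concatMap g (c ∷ u) ++ y) ≡ value 0 (c ∷ u)
      letterValue-start c u y y<s = trans
        (cong₂ atStart (m<n⇒m%n≡m {m = 0} (≤-<-trans z≤n y<s)) (chunks-concatMap (suc r) (c ∷ u) y y<s))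
        (windowed-take windowed 0 (trans (take-take r (suc r) (c ∷ u))
          (cong (λ i → take i (c ∷ u)) (m≤n⇒m⊓n≡m (n≤1+n r)))))

      letterValue-inside : ∀ i w → suc i < s → letterValue (suc i) w ≡ ε
      letterValue-inside i w i<s = cong (λ n → atStart n (chunks (suc r) w)) (m<n⇒m%n≡m i<s)

      runBefore-block : ∀ x y → length x ≡ s → runBefore M letterValue x y ≡ letterValue 0 (x ++ y)
      runBefore-block []      y e = contradiction (sym e) (≢-nonZero⁻¹ s)
      runBefore-block (a ∷ x) y e = trans
        (cong (letterValue 0 (a ∷ x ++ y) ∙_) (runBefore-ε M x y
          (λ i w i<x → letterValue-inside i w (subst (suc i <_) e (s≤s i<x)))))
        (identityʳ (letterValue 0 (a ∷ x ++ y)))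

      -- Within a block all values after the first are `ε`, and in the tail all are, because no
      -- block can be decoded there.
      run-letterValue : ∀ u y → length y < s → run M letterValue (concatMap g u ++ y) ≡ run M value u
      run-letterValue []      y y<s = run-short M y letterValue-short y<s
      run-letterValue (c ∷ u) y y<s = begin
        run M letterValue ((g c ++ concatMap g u) ++ y)
          ≡⟨ cong (run M letterValue) (++-assoc (g c) (concatMap g u) y) ⟩
        run M letterValue (g c ++ rest)
          ≡⟨ run-++ M letterValue (g c) rest ⟩
        runBefore M letterValue (g c) rest ∙ run M (letterValue ∘ (length (g c) +_)) rest
          ≡⟨ cong₂ _∙_
               (trans (runBefore-block (g c) rest (length-g c))
                 (trans (cong (letterValue 0) (sym (++-assoc (g c) (concatMap g u) y)))
                        (letterValue-start c u y y<s)))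
               (run-cong M (λ i w → trans (cong (λ l → letterValue (l + i) w) (length-g c))
                                          (windowed-+ letterValue-windowed i w)) rest) ⟩
        value 0 (c ∷ u) ∙ run M letterValue rest
          ≡⟨ cong (value 0 (c ∷ u) ∙_) (run-letterValue u y y<s) ⟩
        value 0 (c ∷ u) ∙ run M value u
          ≡⟨ cong (value 0 (c ∷ u) ∙_) (run-cong M (λ i w →
               windowed-mod windowed (trans (n%1≡0 i) (sym (n%1≡0 (suc i)))) w) u) ⟩
        value 0 (c ∷ u) ∙ run M (value ∘ suc) u
          ∎
        where
        open ≡-Reasoning
        rest = concatMap g u ++ y

    recogniser-chunks : ∀ {X L : Language k} (y : Word k) → length y < s →
      (∀ w → w ∈ X → ∃[ u ] w ≡ concatMap g u ++ y × u ∈ Y × (w ∈ L ⇔ u ∈ L′)) →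
      Recogniser V (suc r * s) s X L
    recogniser-chunks y y<s blocks = record
      { M        = M
      ; M∈V      = M∈V
      ; value    = letterValue
      ; windowed = letterValue-windowed
      ; accept   = accept
      ; correct  = λ w w∈X → let (u , e , u∈Y , w⇔u) = blocks w w∈X in
          ⇔.trans w⇔u (⇔.trans (correct u u∈Y) (≡⇒⇔ (cong (_∈ₛ accept)
            (sym (trans (cong (run M letterValue) e) (run-letterValue u y y<s))))))
      }

-- Between sentences about words and sentences about words of blocks

hasLetter-≡ : ∀ {k} a {N j} {w w′ : Word k} → j < N → take N w ≡ take N w′ →
              hasLetter a w j ≡ hasLetter a w′ j
hasLetter-≡ a {N} {j} {w} {w′} j<N e =
  trans (sym (hasLetter-take a N w j j<N))
        (trans (cong (λ y → hasLetter a y j) e) (hasLetter-take a N w′ j j<N))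

module _ {f v : Level} {σ : NumericalSignature} {F : Pred (Sentence (numerical σ)) f}
         {V : Pred FiniteMonoid v} (isFragment : IsFragment F) (equivalent : EquivalentTo F V) where

  module _ {k : ℕ} (φ : Sentence (numerical σ ⊕ Local ⊕ MOD)) (φ∈ : φ ∈ Enrich F (Local ⊕ MOD)) where

    private
      N : ℕ
      N = bound (weight⊕ {numerical σ} {Local ⊕ MOD} modWeight) φ

    -- The moduli occurring in φ are at most N.

    definable-blocks : ∃[ N ] ∀ D .{{_ : NonZero D}} → (∀ {d} → NonZero d → d ≤ N → d ∣ D) →
      ∀ {K} (g : Fin K → Word k) → (∀ c → length (g c) ≡ D) → ∀ y →
      DefinableOn (Enrich F Local) U (λ u → concatMap g u ++ y ⊨ φ)
    definable-blocks = N , λ D divides g length-g y → blocks D divides g length-g y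
      where
      module _ (D : ℕ) .{{_ : NonZero D}} (divides : ∀ {d} → NonZero d → d ≤ N → d ∣ D)
               {K} (g : Fin K → Word k) (length-g : ∀ c → length (g c) ≡ D) (y : Word k) where

        gᴿ : Fin K → Word k
        gᴿ = reverse ∘ g

        1≤g : ∀ c → 1 ≤ length (g c)
        1≤g c = subst (1 ≤_) (sym (length-g c)) (>-nonZero⁻¹ D)

        1≤gᴿ : ∀ c → 1 ≤ length (gᴿ c)
        1≤gᴿ c = subst (1 ≤_) (sym (length-reverse (g c))) (1≤g c)

        reverse-blocks : ∀ u → reverse (concatMap g u ++ y) ≡ reverse y ++ (concatMap gᴿ (reverse u) ++ [])
        reverse-blocks u = trans (reverse-++ (concatMap g u) y)
          (cong (reverse y ++_) (trans (reverse-concatMap g u) (sym (++-identityʳ _))))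

        module _ (p q : Word K) where

          Y : Language K
          Y u = (u ∈ U × take N u ≡ p) × take N (reverse u) ≡ q

          X : Language k
          X w = ∃[ u ] u ∈ Y × w ≡ concatMap g u ++ y

          -- Together with `y`, the first and last `N` blocks decide the letters near the ends.
          -- Every modulus that counts divides the length of the blocks, so the length of the whole
          -- word has the residue of the length of `y`.
          constant : Symbol (Local ⊕ MOD) 0 → Bool
          constant (inj₁ (letterMin+ a j))      = hasLetter a (concatMap g p ++ y) j
          constant (inj₁ (letterMax- a j))      = hasLetter a (reverse y ++ (concatMap gᴿ q ++ [])) j
          constant (inj₂ (d , length≡ i)) = does (_%_ (length y) d {{nonZeroIndex i}} ≟ toℕ i)

          constant-sat : ∀ R w → modWeight R ≤ N → w ∈ X →
            T (interp (Local ⊕ MOD) R {length w} (labels w) []) ⇔ T (constant R)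
          constant-sat (inj₁ (letterMin+ a j)) w j<N (u , ((_ , e) , _) , refl) =
            ⇔.trans (min+-sat a j w) (≡⇒⇔ (cong T (hasLetter-≡ a j<N (take-concatMap-≡ g 1≤g N y e))))
          constant-sat (inj₁ (letterMax- a j)) w j<N (u , (_ , e) , refl) =
            ⇔.trans (max--sat a j w) (≡⇒⇔ (cong T (trans (cong (λ z → hasLetter a z j) (reverse-blocks u))
              (hasLetter-≡ a j<N (take-++-cong (reverse y) (m≤n+m N _) (take-concatMap-≡ gᴿ 1≤gᴿ N [] e))))))
          constant-sat (inj₂ (d , length≡ i)) w d≤N (u , _ , refl) =
            ≡⇒⇔ (cong (λ n → T (does (n ≟ toℕ i)))
              (length-concatMap-% length-g u y d {{nonZeroIndex i}} (divides (nonZeroIndex i) d≤N)))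

          class-definable : DefinableOn (Enrich F Local) Y (λ u → concatMap g u ++ y ⊨ φ)
          class-definable =
            let (ψ , ψ∈ , correct) = recogniser⇒formula isFragment equivalent localTarget
                  (recogniser-concatMap length-g
                    (formula⇒recogniser isFragment equivalent (modSource N D divides)
                      X constant constant-sat φ φ∈ ≤-refl) y)
            in ψ , ψ∈ , λ u u∈Y → correct u (u , u∈Y , refl)

        blocks : DefinableOn (Enrich F Local) U (λ u → concatMap g u ++ y ⊨ φ)
        -- The classes prescribe the ends of the word of blocks, so local predicates over the block
        -- alphabet tell them apart.
        blocks = cover-prefix localTarget frag N λ p → cover-suffix localTarget frag N λ q → class-definable p q
          where
          frag : IsFragment (Enrich F Local)
          frag = Enrich-isFragment isFragment

  module _ {K k s : ℕ} .{{_ : NonZero s}} {g : Fin K → Word k} (length-g : ∀ c → length (g c) ≡ s)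
           (injective : ∀ {c c′} → g c ≡ g c′ → c ≡ c′) (surjective : ∀ w → length w ≡ s → ∃[ c ] g c ≡ w) where

    blocks-of : ∀ w → ∃[ u ] ∃[ y ] w ≡ concatMap g u ++ y × length y < s
    blocks-of w = go (length w) w ≤-refl
      where
      go : ∀ n w → length w ≤ n → ∃[ u ] ∃[ y ] w ≡ concatMap g u ++ y × length y < s
      go n w w≤n with length w <? s
      go n       w  w≤n | yes w<s = [] , w , refl , w<s
      go zero    [] _   | no w≮s  = contradiction (>-nonZero⁻¹ s) w≮s
      go (suc n) w  w≤n | no w≮s  =
        let (c , c≡)         = surjective (take s w) (trans (length-take s w) (m≤n⇒m⊓n≡m (≮⇒≥ w≮s)))
            (u , y , e , lt) = go n (drop s w) (subst (_≤ n) (sym (length-drop s w)) (∸-mono w≤n (>-nonZero⁻¹ s)))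
        in c ∷ u , y , trans (sym (take++drop≡id s w))
             (trans (cong₂ _++_ (sym c≡) e) (sym (++-assoc (g c) (concatMap g u) y))) , lt

    private
      gᴿ : Fin K → Word k
      gᴿ = reverse ∘ g

      length-gᴿ : ∀ c → length (gᴿ c) ≡ s
      length-gᴿ c = trans (length-reverse (g c)) (length-g c)

      open Chunks length-g injective
      -- Blocks counted from the end are decoded from the reversed word.
      module ᴿ = Chunks length-gᴿ (injective ∘ reverse-injective)

    module _ {L : Language k} (L? : ∀ w → Dec (w ∈ L))
             (defined : ∀ y → length y < s → Definable⁺ (Enrich F Local) (λ u → concatMap g u ++ y ∈ L)) where

      private
        G : Pred (Sentence (numerical σ ⊕ Local ⊕ MOD^ s)) _
        G = Enrich F (Local ⊕ MOD^ s)

        frag : IsFragment G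
        frag = Enrich-isFragment isFragment
        open IsFragment frag

        -- A prefix `z` of full length guarantees at least one block, as `φ` is only known to be
        -- correct on nonempty words of blocks. The residue `i` of the length tells how many letters
        -- form the tail, and the last `i` letters are then the tail `y` itself.
        module Long (z : Word k) (z≮s : ¬ (length z < s)) (i : Fin s) (y : Word k) (y<s : length y < s)
                    (φ : Sentence (numerical σ ⊕ Local)) (φ∈ : φ ∈ Enrich F Local)
                    (φ-correct : ∀ c u → concatMap g (c ∷ u) ++ y ∈ L ⇔ c ∷ u ⊨ φ) where

          N : ℕ
          N = bound (weight⊕ {numerical σ} {Local} localWeight) φ

          X : Language k
          X w = ((0 < length w × take s w ≡ z) × length w % s ≡ toℕ i) × take (toℕ i) (reverse w) ≡ reverse y

          module _ (p q : Word k) where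

            X′ : Language k
            X′ w = (X w × take (N * s) w ≡ p) × take (length (reverse y) + N * s) (reverse w) ≡ q

            Y : Language K
            Y u = concatMap g u ++ y ∈ X′

            -- The ends of `w` determine those of `u`: `N` blocks occupy `N * s` letters, and at the
            -- right end the tail `y` is removed before decoding.
            constant : Symbol Local 0 → Bool
            constant (letterMin+ a j) = hasLetter a (chunks N p) j
            constant (letterMax- a j) = hasLetter a (ᴿ.chunks N (drop (length (reverse y)) q)) j

            constant-sat : ∀ R u → localWeight R ≤ N → u ∈ Y →
              T (localInterp R {length u} (labels u) []) ⇔ T (constant R)
            constant-sat (letterMin+ a j) u j<N ((_ , e) , _) = ⇔.trans (min+-sat a j u)
              (≡⇒⇔ (cong T (trans (sym (hasLetter-take a N u j j<N)) (cong (λ x → hasLetter a x j) prefix))))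
              where
              prefix : take N u ≡ chunks N p
              prefix = trans (sym (chunks-concatMap N u y y<s))
                (trans (sym (chunks-take N (concatMap g u ++ y))) (cong (chunks N) e))
            constant-sat (letterMax- a j) u j<N (_ , e) = ⇔.trans (max--sat a j u)
              (≡⇒⇔ (cong T (trans (sym (hasLetter-take a N (reverse u) j j<N))
                                  (cong (λ x → hasLetter a x j) suffix))))
              where
              uᴿ : Word k
              uᴿ = concatMap gᴿ (reverse u) ++ []

              reverse-blocks : reverse (concatMap g u ++ y) ≡ reverse y ++ uᴿ
              reverse-blocks = trans (reverse-++ (concatMap g u) y)
                (cong (reverse y ++_) (trans (reverse-concatMap g u) (sym (++-identityʳ _))))

              drop-q : take (N * s) uᴿ ≡ drop (length (reverse y)) q
              drop-q = trans (cong (take (N * s)) (sym (drop-length-++ (reverse y) uᴿ)))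
                (trans (take-drop (N * s) (length (reverse y)) (reverse y ++ uᴿ))
                (cong (drop (length (reverse y))) (trans (cong (take _) (sym reverse-blocks)) e)))

              suffix : take N (reverse u) ≡ ᴿ.chunks N (drop (length (reverse y)) q)
              suffix = trans (sym (ᴿ.chunks-concatMap N (reverse u) [] (>-nonZero⁻¹ s)))
                (trans (sym (ᴿ.chunks-take N uᴿ)) (cong (ᴿ.chunks N) drop-q))

            blocks : ∀ w → w ∈ X′ → ∃[ u ] w ≡ concatMap g u ++ y × u ∈ Y × (w ∈ L ⇔ u ⊨ φ)
            blocks w w∈X′@(((((_ , take≡z) , length≡i) , tail≡) , _) , _) with blocks-of w
            ... | u , y′ , refl , y′<s = u , w≡ , subst X′ w≡ w∈X′ , ⇔.trans (≡⇒⇔ (cong L w≡)) (φ-correct′ u z≤w)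
              where
              y′-length : length (reverse y′) ≡ toℕ i
              y′-length = trans (length-reverse y′) (trans (sym (m<n⇒m%n≡m y′<s))
                (trans (sym (length-concatMap-% length-g u y′ s ∣-refl)) length≡i))

              y′≡y : y′ ≡ y
              y′≡y = reverse-injective (begin
                reverse y′
                  ≡⟨ take-length-++ (reverse y′) (reverse (concatMap g u)) ⟨
                take (length (reverse y′)) (reverse y′ ++ reverse (concatMap g u))
                  ≡⟨ cong₂ take y′-length (sym (reverse-++ (concatMap g u) y′)) ⟩
                take (toℕ i) (reverse w)
                  ≡⟨ tail≡ ⟩
                reverse y
                  ∎)
                where open ≡-Reasoning

              w≡ : w ≡ concatMap g u ++ y
              w≡ = cong (concatMap g u ++_) y′≡y

              z≤w : length z ≤ length (concatMap g u ++ y)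
              z≤w = subst₂ _≤_ (trans (sym (length-take s w)) (cong length take≡z)) (cong length w≡)
                               (m⊓n≤n s (length w))

              φ-correct′ : ∀ u → length z ≤ length (concatMap g u ++ y) → concatMap g u ++ y ∈ L ⇔ u ⊨ φ
              φ-correct′ []      z≤y = contradiction (≤-<-trans z≤y y<s) z≮s
              φ-correct′ (c ∷ u) _   = φ-correct c u

            class-definable : DefinableOn G X′ L
            class-definable = recogniser⇒formula isFragment equivalent (modTarget s)
              (recogniser-chunks
                (formula⇒recogniser isFragment equivalent (localSource N) Y constant constant-sat φ φ∈ ≤-refl)
                y y<s blocks)

          definable : DefinableOn G X L
          definable = cover-prefix (modTarget s) frag (N * s) λ p →
            cover-suffix (modTarget s) frag (length (reverse y) + N * s) λ q → class-definable p q

        single : ∀ {X : Language k} z → (∀ w → w ∈ X → w ≡ z) → DefinableOn G X L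
        single z X⊆z with L? z
        ... | yes z∈L = ⊤′ , quantifier-free ⊤′ , λ w w∈X → mk⇔ _ (λ _ → subst L (sym (X⊆z w w∈X)) z∈L)
        ... | no  z∉L = ⊥′ , quantifier-free ⊥′ , λ w w∈X → mk⇔ (λ w∈L → z∉L (subst L (X⊆z w w∈X) w∈L)) (λ ())

        long : ∀ z → ¬ (length z < s) → DefinableOn G (λ w → 0 < length w × take s w ≡ z) L
        long z z≮s = cover frag s (λ i → atom (inj₂ (inj₂ (length≡ i))) [])
          (λ i w → (0 < length w × take s w ≡ z) × length w % s ≡ toℕ i) (λ i → atom _ [])
          (λ w _ → residue w , from (length-sat (residue w) w) (sym (toℕ-fromℕ< (m%n<n (length w) s))))
          (λ i w w∈X t → w∈X , to (length-sat i w) t)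
          (λ i → cover-suffix (modTarget s) frag (toℕ i) λ z′ → tail i z′)
          where
          residue : Word k → Fin s
          residue w = fromℕ< (m%n<n (length w) s)

          length-sat : ∀ i w → T (modRelation (length≡ i) (length w) []) ⇔ length w % s ≡ toℕ i
          length-sat i w = T-does (length w % s ≟ toℕ i)

          tail : ∀ i z′ → DefinableOn G (λ w → ((0 < length w × take s w ≡ z) × length w % s ≡ toℕ i)
                                              × take (toℕ i) (reverse w) ≡ z′) L
          tail i z′ with length (reverse z′) <? s
          ... | yes y<s = let (φ , φ∈ , φ-correct) = defined (reverse z′) y<s
                              (ψ , ψ∈ , ψ-correct) = Long.definable z z≮s i (reverse z′) y<s φ φ∈ φ-correct
                          in ψ , ψ∈ , λ w (w∈X , e) → ψ-correct w (w∈X , trans e (sym (reverse-involutive z′)))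
          -- An empty class: at most `i` letters were taken, and `i` is below `s`.
          ... | no y≮s  = ⊥′ , quantifier-free ⊥′ , λ w (_ , e) → contradiction
            (subst (_< s) (trans (sym (length-take (toℕ i) (reverse w)))
                                 (trans (cong length e) (sym (length-reverse z′))))
              (≤-<-trans (m⊓n≤m (toℕ i) _) (toℕ<n i))) y≮s

        -- If the first `s` letters are fewer than `s`, they are the whole word. The class has at
        -- most one member, and deciding whether `z` lies in `L` selects `⊤′` or `⊥′`.
        short : ∀ z → length z < s → DefinableOn G (λ w → 0 < length w × take s w ≡ z) L
        short z z<s = single z λ w (_ , e) → trans (sym (take-all s w (w≤s w e))) e
          where
          w≤s : ∀ w → take s w ≡ z → length w ≤ s
          w≤s w e with length w ≤? s
          ... | yes w≤s = w≤s
          ... | no  w≰s = contradiction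
            (trans (sym (cong length e)) (trans (length-take s w) (m≤n⇒m⊓n≡m (<⇒≤ (≰⇒> w≰s)))))
            (<⇒≢ z<s)

        nonempty-definable : DefinableOn G (λ w → 0 < length w) L
        nonempty-definable = cover-prefix (modTarget s) frag s class
          where
          class : ∀ z → DefinableOn G (λ w → 0 < length w × take s w ≡ z) L
          class z with length z <? s
          ... | yes z<s = short z z<s
          ... | no  z≮s = long z z≮s

      definable-from-blocks : Definable⁺ (Enrich F (Local ⊕ MOD^ s)) L
      definable-from-blocks = let (φ , φ∈ , correct) = nonempty-definable
                              in φ , φ∈ , λ a w → correct (a ∷ w) (s≤s z≤n)

-- Stability

module _ {k : ℕ} where

  block : ∀ s → Fin (k ^ s) → Word k
  block s c = tabulate (finToFun {k} {s} c)

  length-block : ∀ s c → length (block s c) ≡ s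
  length-block s c = length-tabulate (finToFun {k} {s} c)

  block-injective : ∀ s {c c′} → block s c ≡ block s c′ → c ≡ c′
  block-injective s {c} {c′} e = trans (sym (funToFin-finToFin {s} {k} c))
    (trans (funToFin-cong (finToFun {k} {s} c) (finToFun {k} {s} c′) (tabulate-injective _ _ e))
           (funToFin-finToFin {s} {k} c′))
    where
    tabulate-injective : ∀ {n} (f g : Fin n → Fin k) → tabulate f ≡ tabulate g → ∀ i → f i ≡ g i
    tabulate-injective f g e zero    = cong (λ { (x ∷ _) → x ; [] → f zero }) e
    tabulate-injective f g e (suc i) = tabulate-injective (f ∘ suc) (g ∘ suc) (cong (drop 1) e) i

    funToFin-cong : ∀ {n} (f g : Fin n → Fin k) → (∀ i → f i ≡ g i) → funToFin f ≡ funToFin g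
    funToFin-cong {zero}  f g e = refl
    funToFin-cong {suc n} f g e = cong₂ combine (e zero) (funToFin-cong (f ∘ suc) (g ∘ suc) (e ∘ suc))

  block-surjective : ∀ s w → length w ≡ s → ∃[ c ] block s c ≡ w
  block-surjective _ w refl = funToFin (lookup w) ,
    trans (tabulate-cong (finToFun-funToFin (lookup w))) (tabulate-lookup w)

MOD^⇒MOD : ∀ {S} s → Translation (S ⊕ Local ⊕ MOD^ s) (S ⊕ Local ⊕ MOD)
MOD^⇒MOD {S} s = record { onLetter = letterᴸ ; onAtom = λ R → atomᴸ (rename R) }
  where
  rename : ∀ {r} → Symbol (S ⊕ Local ⊕ MOD^ s) r → Symbol (S ⊕ Local ⊕ MOD) r
  rename (inj₁ R)        = inj₁ R
  rename (inj₂ (inj₁ R)) = inj₂ (inj₁ R)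
  rename (inj₂ (inj₂ R)) = inj₂ (inj₂ (s , R))

definable-MOD^⇒MOD : ∀ {f S} {F : Pred (Sentence S) f} {k} {L : Language k} s →
  Definable⁺ (Enrich F (Local ⊕ MOD^ s)) L → Definable⁺ (Enrich F (Local ⊕ MOD)) L
definable-MOD^⇒MOD {S = S} s (φ , φ∈ , correct) = translate (MOD^⇒MOD s) φ , Enrich⇒Enrich (MOD^⇒MOD s) φ∈ ,
  λ a w → ⇔.trans (correct a w)
    (translate-sat (MOD^⇒MOD s) (λ _ → 0) _ (labels (a ∷ w)) (labels (a ∷ w)) (λ _ _ _ _ → ⇔.refl)
      (λ { (inj₁ R)        xs ρ θ _ → ⇔.refl
         ; (inj₂ (inj₁ R)) xs ρ θ _ → ⇔.refl
         ; (inj₂ (inj₂ R)) xs ρ θ _ → ⇔.refl })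
      φ [] [] ≤-refl)

module _ {k : ℕ} (L : Language k) where
  open Syntactic L
  open Monoid syntacticMonoid using (∙-cong; reflexive) renaming (refl to ∼-refl; trans to ∼-trans)

  -- Replacing the first `s` letters by an equivalent word of length `2 * s` lengthens a word by
  -- `s`; this is repeated.
  stable-power : ∀ {s} → Stable s → ∀ m .{{_ : NonZero m}} u → length u ≡ s →
                 ∃[ u′ ] length u′ ≡ m * s × u′ ∼ u
  stable-power {s} stable (suc zero)    u e = u , trans e (sym (+-identityʳ s)) , ∼-refl {u}
  stable-power {s} stable (suc (suc m)) u e
    with stable-power stable (suc m) u e
  ... | u₁ , e₁ , u₁∼u
    with proj₁ stable (take s u₁
      , trans (length-take s u₁) (m≤n⇒m⊓n≡m (subst (s ≤_) (sym e₁) (m≤m+n s (m * s))))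
      , ∼-refl {take s u₁})
  ... | x , ex , x∼ = x ++ drop s u₁ , len ,
    ∼-trans {x ++ drop s u₁} {u₁} {u}
      (∼-trans {x ++ drop s u₁} {take s u₁ ++ drop s u₁} {u₁}
        (∙-cong {x} {take s u₁} {drop s u₁} {drop s u₁} x∼ (∼-refl {drop s u₁}))
        (reflexive (take++drop≡id s u₁)))
      u₁∼u
    where
    open ≡-Reasoning
    len : length (x ++ drop s u₁) ≡ s + (s + m * s)
    len = begin
      length (x ++ drop s u₁)        ≡⟨ length-++ x ⟩
      length x + length (drop s u₁)  ≡⟨ cong₂ _+_ ex (trans (length-drop s u₁) (cong (_∸ s) e₁)) ⟩
      2 * s + (s + m * s ∸ s)        ≡⟨ cong (2 * s +_) (m+n∸m≡n s (m * s)) ⟩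
      (s + (s + 0)) + m * s          ≡⟨ cong (λ n → (s + n) + m * s) (+-identityʳ s) ⟩
      (s + s) + m * s                ≡⟨ +-assoc s s (m * s) ⟩
      s + (s + m * s)                ∎

  concatMap-∼ : ∀ {K} {g g′ : Fin K → Word k} → (∀ c → g c ∼ g′ c) → ∀ u → concatMap g u ∼ concatMap g′ u
  concatMap-∼ g∼g′ []      = ∼-refl {[]}
  concatMap-∼ {g = g} {g′} g∼g′ (c ∷ u) =
    ∙-cong {g c} {g′ c} {concatMap g u} {concatMap g′ u} (g∼g′ c) (concatMap-∼ g∼g′ u)

-- Automata for block languages, and the existence of a stable length

module _ {k : ℕ} (𝒜 : DFA k) where
  open DFA 𝒜

  language? : ∀ w → Dec (w ∈ language)
  language? w = _ ∈? final

  -- Keeps the block languages in the form of automata, the input that a decision procedure in the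
  -- sense of `Decidable⁺` takes.
  quotientDFA : ∀ {K} → (Fin K → Word k) → Word k → DFA K
  quotientDFA g y = record
    { states = states ; start = start ; step = λ q c → foldl step q (g c)
    ; final  = subset (λ q → does (foldl step q y ∈? final))
    }

  quotientDFA-language : ∀ {K} (g : Fin K → Word k) y u →
    u ∈ DFA.language (quotientDFA g y) ⇔ concatMap g u ++ y ∈ language
  quotientDFA-language g y u = ⇔.trans (∈-subset _ _) (⇔.trans (T-does (_ ∈? final))
    (≡⇒⇔ (cong (_∈ₛ final) (trans (cong (λ q → foldl step q y) (sym (go start u)))
                                  (sym (foldl-++ step start (concatMap g u) y))))))
    where
    go : ∀ q u → foldl step q (concatMap g u) ≡ foldl (λ q c → foldl step q (g c)) q u
    go q []      = refl
    go q (c ∷ u) = trans (foldl-++ step q (g c) (concatMap g u)) (go (foldl step q (g c)) u)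

  private
    infix 4 _≈_
    -- Equality of the induced maps on states: it refines syntactic equivalence, and there are only
    -- finitely many such maps.
    _≈_ : Word k → Word k → Set
    u ≈ u′ = ∀ q → foldl step q u ≡ foldl step q u′

    ≈⇒∼ : ∀ {u u′} → u ≈ u′ → Syntactic._∼_ language u u′
    ≈⇒∼ {u} {u′} e x y = ≡⇒⇔ (cong (_∈ₛ final)
      (trans (split u) (trans (cong (λ q → foldl step q y) (e _)) (sym (split u′)))))
      where
      split : ∀ u → foldl step start (x ++ u ++ y) ≡ foldl step (foldl step (foldl step start x) u) y
      split u = trans (foldl-++ step start x (u ++ y)) (foldl-++ step (foldl step start x) u y)

    _↝_ : ℕ → ℕ → Set
    m ↝ n = ∀ u → length u ≡ m → ∃[ u′ ] length u′ ≡ n × u ≈ u′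

    ↝-trans : ∀ {l m n} → l ↝ m → m ↝ n → l ↝ n
    ↝-trans a b u e = let (u₁ , e₁ , x) = a u e ; (u₂ , e₂ , y) = b u₁ e₁ in u₂ , e₂ , λ q → trans (x q) (y q)

    ↝-+ : ∀ {m n} → m ↝ n → ∀ l → (m + l) ↝ (n + l)
    ↝-+ {m} {n} a l u e
      with a (take m u) (trans (length-take m u) (m≤n⇒m⊓n≡m (subst (m ≤_) (sym e) (m≤m+n m l))))
    ... | x , ex , u≈x = x ++ drop m u
      , trans (length-++ x) (cong₂ _+_ ex (trans (length-drop m u) (trans (cong (_∸ m) e) (m+n∸m≡n m l))))
      , λ q → trans (cong (foldl step q) (sym (take++drop≡id m u)))
          (trans (foldl-++ step q (take m u) (drop m u))
          (trans (cong (λ q → foldl step q (drop m u)) (u≈x q)) (sym (foldl-++ step q x (drop m u)))))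

    effect : Word k → Fin (states ^ states)
    effect u = funToFin (λ q → foldl step q u)

    effect-≈ : ∀ {u u′} → effect u ≡ effect u′ → u ≈ u′
    effect-≈ {u} {u′} e q = trans (sym (finToFun-funToFin (λ q → foldl step q u) q))
      (trans (cong (λ t → finToFun {states} {states} t q) e) (finToFun-funToFin (λ q → foldl step q u′) q))

    realised? : ∀ n t → Dec (∃[ c ] effect (block {k} n c) ≡ t)
    realised? n t = any? (λ c → effect (block n c) Fin.≟ t)

    -- Equal codes mean that two lengths realise the same state maps. As the codes are finite in
    -- number, two lengths must share one.
    effects : ℕ → Fin (2 ^ (states ^ states))
    effects n = funToFin (λ t → if does (realised? n t) then suc zero else zero)

    effects-↝ : ∀ {m n} → effects m ≡ effects n → m ↝ n
    effects-↝ {m} {n} e u eu = search (realised? m t) (realised? n t)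
      (trans (sym (finToFun-funToFin _ t)) (trans (cong (λ z → finToFun z t) e) (finToFun-funToFin _ t)))
      where
      t = effect u
      search : (d : Dec (∃[ c ] effect (block m c) ≡ t)) (d′ : Dec (∃[ c ] effect (block n c) ≡ t)) →
        (if does d then suc zero else zero) ≡ (if does d′ then suc zero else zero {1}) →
        ∃[ u′ ] length u′ ≡ n × u ≈ u′
      search _       (yes (c , e′)) _ = block n c , length-block n c , effect-≈ {u} {block n c} (sym e′)
      search (yes _) (no _)         ()
      search (no ∄)  (no _)         _ = let (c , e′) = block-surjective m u eu
                                        in contradiction (c , cong effect e′) ∄

  stable-exists : ∃[ s ] 1 ≤ s × Syntactic.Stable language s
  stable-exists with pigeonhole (n<1+n (2 ^ (states ^ states))) (effects ∘ toℕ)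
  ... | a , b , a<b , e = s , 1≤s , (stable s↝2s) , (stable 2s↝s)
    where
    i = toℕ a
    p = toℕ b ∸ toℕ a
    -- From `i` on, the realised maps are periodic in the length with period `p`. This multiple of
    -- `p` is at least `i`, hence lies in the periodic range together with its double; `suc i`
    -- instead of `i` keeps it positive when `i` is 0.
    s = suc i * p

    i+p : i + p ≡ toℕ b
    i+p = m+[n∸m]≡n (<⇒≤ a<b)

    1≤p : 1 ≤ p
    1≤p = m<n⇒0<n∸m a<b

    1≤s : 1 ≤ s
    1≤s = ≤-trans 1≤p (m≤m+n p (i * p))

    i≤s : i ≤ s
    i≤s = ≤-trans (n≤1+n i) (subst (_≤ s) (*-identityʳ (suc i)) (*-monoʳ-≤ (suc i) 1≤p))

    up : ∀ m → i ↝ (i + m * p)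
    up zero    = subst (i ↝_) (sym (+-identityʳ i)) (λ u e → u , e , λ _ → refl)
    up (suc m) = ↝-trans (up m) (subst ((i + m * p) ↝_) (+-assoc i p (m * p))
      (↝-+ (subst (i ↝_) (sym i+p) (effects-↝ e)) (m * p)))

    down : ∀ m → (i + m * p) ↝ i
    down zero    = subst (_↝ i) (sym (+-identityʳ i)) (λ u e → u , e , λ _ → refl)
    down (suc m) = ↝-trans (subst (_↝ (i + m * p)) (+-assoc i p (m * p))
      (↝-+ (subst (_↝ i) (sym i+p) (effects-↝ (sym e))) (m * p))) (down m)

    i+n≡s : i + (s ∸ i) ≡ s
    i+n≡s = m+[n∸m]≡n i≤s

    i+s+n≡2s : i + s + (s ∸ i) ≡ 2 * s
    i+s+n≡2s = begin
      i + s + (s ∸ i)    ≡⟨ cong (_+ (s ∸ i)) (+-comm i s) ⟩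
      s + i + (s ∸ i)    ≡⟨ +-assoc s i (s ∸ i) ⟩
      s + (i + (s ∸ i))  ≡⟨ cong (s +_) (trans i+n≡s (sym (+-identityʳ s))) ⟩
      2 * s              ∎
      where open ≡-Reasoning

    s↝2s : s ↝ (2 * s)
    -- `up (suc i)` leads from `i` to `i + s`; appending `s ∸ i` letters on both sides gives `s` and
    -- `2 * s`.
    s↝2s = subst₂ _↝_ i+n≡s i+s+n≡2s (↝-+ (up (suc i)) (s ∸ i))

    2s↝s : (2 * s) ↝ s
    2s↝s = subst₂ _↝_ i+s+n≡2s i+n≡s (↝-+ (down (suc i)) (s ∸ i))

    stable : ∀ {m n} → m ↝ n → Syntactic.imageOfLength language m ⊆ Syntactic.imageOfLength language n
    stable r {x} (u , e , u∼x) = let (u′ , e′ , u≈u′) = r u e in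
      u′ , e′ , λ y z → ⇔.trans (⇔.sym (≈⇒∼ u≈u′ y z)) (u∼x y z)

-- The equivalence for stable lengths and the transfer of decidability

module _ {f v : Level} {σ : NumericalSignature} {F : Pred (Sentence (numerical σ)) f}
         {V : Pred FiniteMonoid v} (isFragment : IsFragment F) (equivalent : EquivalentTo F V) where

  module _ {k s : ℕ} .{{_ : NonZero s}} (L : Language k) (stable : Syntactic.Stable L s) where
    open Syntactic L using (_∼_)

    module _ (N : ℕ) (φ : Sentence (numerical σ ⊕ Local ⊕ MOD)) (φ-correct : ∀ a w → a ∷ w ∈ L ⇔ a ∷ w ⊨ φ)
             (definable : ∀ D .{{_ : NonZero D}} → (∀ {d} → NonZero d → d ≤ N → d ∣ D) →
                ∀ {K} (g : Fin K → Word k) → (∀ c → length (g c) ≡ D) → ∀ y →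
                DefinableOn (Enrich F Local) U (λ u → concatMap g u ++ y ⊨ φ)) where

      private
        instance
          N!≢0 : NonZero (N !)
          N!≢0 = N !≢0

        -- `N ! * s` is a multiple of `s`, so stability provides equivalent words of this length,
        -- and also a multiple of every positive modulus up to `N`.
        stretched : ∀ c → ∃[ x ] length x ≡ N ! * s × x ∼ block s c
        stretched c = stable-power L stable (N !) (block s c) (length-block s c)

        stretch : Fin (k ^ s) → Word k
        stretch c = proj₁ (stretched c)

        length-stretch : ∀ c → length (stretch c) ≡ N ! * s
        length-stretch c = proj₁ (proj₂ (stretched c))

        stretch∼ : ∀ c → stretch c ∼ block s c
        stretch∼ c = proj₂ (proj₂ (stretched c))

        divides : ∀ {d} → NonZero d → d ≤ N → d ∣ N ! * s
        divides {suc d} _ d≤N = ∣-trans (∣-trans (m∣m*n (d !)) (m≤n⇒m!∣n! d≤N)) (m∣m*n s)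

        ψ-definable : ∀ y → DefinableOn (Enrich F Local) U (λ u → concatMap stretch u ++ y ⊨ φ)
        ψ-definable = definable (N ! * s) {{m*n≢0 (N !) s}} divides stretch length-stretch

        correct : ∀ w → 1 ≤ length w → w ∈ L ⇔ w ⊨ φ
        correct (a ∷ w) _ = φ-correct a w

        nonempty-correct : ∀ y c u → concatMap stretch (c ∷ u) ++ y ∈ L ⇔ concatMap stretch (c ∷ u) ++ y ⊨ φ
        nonempty-correct y c u = correct _
          (subst (1 ≤_) (sym (length-concatMap {g = stretch} length-stretch (c ∷ u) y))
          (≤-trans (>-nonZero⁻¹ (N ! * s) {{m*n≢0 (N !) s}})
                   (≤-trans (m≤m+n _ (length u * (N ! * s))) (m≤m+n _ (length y)))))

      -- Blocks may be replaced by their stretched versions without changing membership in `L`, and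
      -- over stretched blocks the modular predicates of `φ` have been eliminated.
      stretched-definable : ∀ y → Definable⁺ (Enrich F Local) (λ u → concatMap (block s) u ++ y ∈ L)
      stretched-definable y = let (ψ , ψ∈ , ψ-correct) = ψ-definable y in ψ , ψ∈ , λ c u →
        ⇔.trans (⇔.sym (concatMap-∼ L stretch∼ (c ∷ u) [] y))
                (⇔.trans (nonempty-correct y c u) (ψ-correct (c ∷ u) _))

    definable⇒blocks : Definable⁺ (Enrich F (Local ⊕ MOD)) L →
      ∀ y → Definable⁺ (Enrich F Local) (λ u → concatMap (block s) u ++ y ∈ L)
    definable⇒blocks (φ , φ∈ , φ-correct) =
      let (N , definable) = definable-blocks isFragment equivalent φ φ∈ in
      stretched-definable N φ φ-correct definable

    module _ (L? : ∀ w → Dec (w ∈ L)) where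

      blocks⇒definable :
        (∀ y → length y < s → Definable⁺ (Enrich F Local) (λ u → concatMap (block s) u ++ y ∈ L)) →
        Definable⁺ (Enrich F (Local ⊕ MOD^ s)) L
      blocks⇒definable = definable-from-blocks isFragment equivalent
        (length-block s) (block-injective s) (block-surjective s) L?

  definable-MOD⇒MOD^ : ∀ {k} {L : Language k} → (∀ w → Dec (w ∈ L)) →
    ∀ s .{{_ : NonZero s}} → Syntactic.Stable L s →
    Definable⁺ (Enrich F (Local ⊕ MOD)) L → Definable⁺ (Enrich F (Local ⊕ MOD^ s)) L
  definable-MOD⇒MOD^ {L = L} L? s stable d = blocks⇒definable L stable L? (λ y _ → definable⇒blocks L stable d y)

  module _ {k s : ℕ} .{{_ : NonZero s}} (𝒜 : DFA k) (stable : Syntactic.Stable (DFA.language 𝒜) s) where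

    private
      L : Language k
      L = DFA.language 𝒜

      blockDFA : Word k → DFA (k ^ s)
      blockDFA = quotientDFA 𝒜 (block s)

      -- The words `y` shorter than `s` are enumerated by length and code, which turns the condition
      -- into a finite conjunction of decidable statements.
      Blocks : Set _
      Blocks = ∀ (l : Fin s) (c : Fin (k ^ toℕ l)) →
        Definable⁺ (Enrich F Local) (DFA.language (blockDFA (block (toℕ l) c)))

      transport : ∀ {K} {L₁ L₂ : Language K} → (∀ u → u ∈ L₁ ⇔ u ∈ L₂) →
                  Definable⁺ (Enrich F Local) L₁ → Definable⁺ (Enrich F Local) L₂
      transport e (φ , φ∈ , correct) = φ , φ∈ , λ a w → ⇔.trans (⇔.sym (e (a ∷ w))) (correct a w)

      ⇒blocks : Definable⁺ (Enrich F (Local ⊕ MOD)) L → Blocks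
      ⇒blocks d l c = transport (λ u → ⇔.sym (quotientDFA-language 𝒜 (block s) (block (toℕ l) c) u))
        (definable⇒blocks L stable d (block (toℕ l) c))

      blocks⇒ : Blocks → Definable⁺ (Enrich F (Local ⊕ MOD)) L
      blocks⇒ blocks = definable-MOD^⇒MOD {L = L} s (blocks⇒definable L stable (language? 𝒜) λ y y<s →
        let l = fromℕ< y<s
            (c , e) = block-surjective (toℕ l) y (sym (toℕ-fromℕ< y<s))
        in transport (λ u → ⇔.trans (quotientDFA-language 𝒜 (block s) (block (toℕ l) c) u)
                                    (≡⇒⇔ (cong (λ y → concatMap (block s) u ++ y ∈ L) e)))
                     (blocks l c))

    decidable-stable : Decidable⁺ (Enrich F Local) → Dec (Definable⁺ (Enrich F (Local ⊕ MOD)) L)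
    decidable-stable decide = map′ blocks⇒ ⇒blocks (all? λ l → all? λ c → decide (blockDFA (block (toℕ l) c)))

  decidable-MOD : Decidable⁺ (Enrich F Local) → Decidable⁺ (Enrich F (Local ⊕ MOD))
  decidable-MOD decide 𝒜 =
    let (s , 1≤s , stable) = stable-exists 𝒜 in decidable-stable {{>-nonZero 1≤s}} 𝒜 stable decide

theorem9 : ∀ {f v : Level} (σ : NumericalSignature) (F : Pred (Sentence (numerical σ)) f) (V : Pred FiniteMonoid v) →
    IsFragment F → IsVariety V → EquivalentTo F V → ¬ (V ⊆ IsGroupMonoid) →
    (∀ {k : ℕ} (L : Language k) → Regular L → ∀ (s : ℕ) → IsStabilityIndex L s →
    Definable⁺ (Enrich F (Local ⊕ MOD)) L ⇔ Definable⁺ (Enrich F (Local ⊕ MOD^ s)) L)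
    × (Decidable⁺ (Enrich F Local) → Decidable⁺ (Enrich F (Local ⊕ MOD)))
theorem9 σ F V isFragment _ equivalent _ =
  (λ L (𝒜 , correct) s index → let open IsStabilityIndex index in mk⇔
    (definable-MOD⇒MOD^ isFragment equivalent
      (λ w → map′ (from (correct w)) (to (correct w)) (language? 𝒜 w)) s {{>-nonZero positive}} stable)
    (definable-MOD^⇒MOD {L = L} s))
  , decidable-MOD isFragment equivalent
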